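{- Let $k\ge 1$ and let $\xi=(x,L,y)$ be a 2RDPQ over the alphabet $\Sigma$ such that $L$ is given by an NRA or an REM containing at most $k$ registers. Then a 2RRDPQ $\xi'=(x,L',y)$ over the alphabet $\Sigma^{\pm}\cup\{A_i,A_i^-\mid 1\le i\le k\}$ can be constructed in polynomial time such that for every data graph $\mathscr{G}=(V,E,\eta)$ over $\Sigma$, $\xi(\mathscr{G})=\xi'(\mathscr{G}_{dn,k})$, where $\mathscr{G}_{dn,k}$ is the data-to-node $k$-transformation of $\mathscr{G}$.
   Context: $\Sigma$ is a finite alphabet, $\mathbb{D}$ an infinite set of data values, $\Sigma^{\pm}=\Sigma\cup\{a^-\mid a\in\Sigma\}$, with $(a^-)^-=a$; $A_1,\dots,A_k$ are symbols not in $\Sigma$. Data paths. A data path over a finite alphabet $\Lambda$ is a sequence $\alpha=d_0a_1d_1\dots a_nd_n$ ($n\ge 0$, $d_i\in\mathbb{D}$, $a_i\in\Lambda$). Its positions are $0,\dots,2n$; $d_i$ is at position $2i$ and $a_i$ at position $2i-1$. The concatenation $\alpha_1\cdot\alpha_2$ is defined when the last data value of $\alpha_1$ equals the first of $\alpha_2$, these two being merged. Register constraints. $k$-register data constraints ($\mathcal{C}_k$): $c:=r_i\sim r_j\mid r_i\not\sim r_j\mid c\vee c\mid c\wedge c$, $0\le i,j\le k$, $i\ne j$; $r_0$ stands for the current data value. For $\theta\in(\mathbb{D}\cup\{\bot\})^{[k]}$ ($[k]=\{1,\dots,k\}$) and $d\in\mathbb{D}$, extend $\theta$ by $\theta(0)=d$;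 $(\theta,d)\models r_i\sim r_j$ iff $\theta(i),\theta(j)\ne\bot$ and $\theta(i)=\theta(j)$; $\not\sim$ is the negation of $\sim$; $\vee,\wedge$ as usual. $\theta_\bot$ is the constant-$\bot$ assignment. NRA. A nondeterministic $k$-register data path automaton over $\Lambda$ is $(Q,k,\delta,I,F)$ with $Q=Q_w\cup Q_d$ finite disjoint, $I\subseteq Q_d$, $F\subseteq Q_w$, $\delta=\delta_w\cup\delta_d$ finite, $\delta_w\subseteq Q_w\times\Lambda\times Q_d$, $\delta_d\subseteq Q_d\times\mathcal{C}_k\times Q_w\times 2^{[k]}$. It reads $\alpha$ symbol by symbol from a state in $I$ with registers $\theta_\bot$: on a word symbol $a$ it uses $(q,a,q')\in\delta_w$, leaving $\theta$ unchanged; on a data value $d$ it uses $(q,c,q',X)\in\delta_d$ with $(\theta,d)\models c$ and then assigns $d$ to every register in $X$. It accepts if it can be in a state of $F$ after the whole data path. REM (regular expressions with $k$-memory) over $\Lambda$: $e:=\varepsilon\mid\emptyset\mid a\mid e\cdot e\mid e\cup e\mid e^+\mid\downarrow_X e\mid e[c]$, $a\in\Lambda$, $c\in\mathcal{C}_k$, $X\subseteq[k]$. The relation $\theta\vdash_{e,\alpha}\theta'$: for $\varepsilon$: $\alpha$ is a single data value and $\theta'=\theta$; for $\emptyset$: never; for $a$: $\alpha=dad'$ and $\theta'=\theta$; for $e_1\cdot e_2$: $\alpha=\alpha_1\cdot\alpha_2$ and $\theta\vdash_{e_1,\alpha_1}\theta''\vdash_{e_2,\alpha_2}\theta'$ for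 some $\theta''$; $\cup$ is union; $e^+$ is iterated concatenation one or more times; $\theta\vdash_{\downarrow_X e_1,\alpha}\theta'$ iff $\theta_{X=d}\vdash_{e_1,\alpha}\theta'$, with $d$ the first data value of $\alpha$ and $\theta_{X=d}$ obtained from $\theta$ by assigning $d$ to all registers in $X$; $\theta\vdash_{e_1[c],\alpha}\theta'$ iff $\theta\vdash_{e_1,\alpha}\theta'$ and $(\theta',d)\models c$, with $d$ the last data value of $\alpha$. $\alpha\in\mathscr{L}(e)$ iff $\theta_\bot\vdash_{e,\alpha}\theta$ for some $\theta$. Position terms over $\Lambda$: $t:=cur\mid suc(t)\mid pred(t)\mid suc_A(t)\mid pred_A(t)$, $\emptyset\ne A\subseteq\Lambda$. For $\alpha$ and an even position $2i$: $cur_\alpha[2i]=2i$; $(suc(cur))_\alpha[2i]=2(i+1)$ if $i<n$, else $\bot$; $(pred(cur))_\alpha[2i]=2(i-1)$ if $i>0$, else $\bot$; $(suc_A(cur))_\alpha[2i]=2j$ for the least $j$ with $i<j\le n$, $a_j\in A$, and $\bot$ if none; $(pred_A(cur))_\alpha[2i]=2(j-1)$ for the largest $j$ with $1\le j\le i$, $a_j\in A$, and $\bot$ if none; $(op(t))_\alpha[2i]=(op(cur))_\alpha[t_\alpha[2i]]$ if $t_\alpha[2i]\ne\bot$, else $\bot$. Rigid data constraints: $c:=t_1\sim t_2\mid t_1\not\sim t_2\mid c\vee c\mid c\wedge c$; $(\alpha,2i)\models t_1\sim t_2$ iff both $(t_1)_\alpha[2i],(t_2)_\alpha[2i]\ne\bot$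 and the data values at these positions are equal; $\not\sim$ is the negation of $\sim$. NRRA over $\Lambda$: $(Q,\delta,I,F)$ with $Q=Q_w\cup Q_d$ finite disjoint, $I\subseteq Q_d$, $F\subseteq Q_w$, $\delta=\delta_w\cup\delta_d$ finite, $\delta_w\subseteq Q_w\times\Lambda\times Q_d$, $\delta_d$ consisting of triples $(q,c,q')\in Q_d\times\{\text{rigid data constraints over }\Lambda\}\times Q_w$. A run over $\alpha$ is $q_0c_0q_1a_1q_2\dots a_nq_{2n}c_nq_{2n+1}$ with $q_0\in I$, $(q_{2i},c_i,q_{2i+1})\in\delta_d$, $(\alpha,2i)\models c_i$, $(q_{2i-1},a_i,q_{2i})\in\delta_w$; accepting if $q_{2n+1}\in F$. RREM over $\Lambda$: $e:=\varepsilon\mid a\mid[c]\mid e\cup e\mid e\cdot e\mid e^+$ with $c$ a rigid data constraint; for even positions $i\le j$: $(\alpha,i)\vdash_\varepsilon(\alpha,j)$ iff $i=j$; $\vdash_a$ iff $j=i+2$ and the symbol at $i+1$ is $a$; $\vdash_{[c]}$ iff $i=j$ and $(\alpha,i)\models c$; $\cup,\cdot,{}^+$ are union, composition, transitive closure; $\alpha$ is accepted iff $(\alpha,0)\vdash_e(\alpha,2n)$. Queries. A data graph over $\Sigma$ is $\mathscr{G}=(V,E,\eta)$, $E\subseteq V\times\Sigma\times V$, $\eta:V\to\mathbb{D}$. A semipath $\pi=v_0a_1v_1\dots a_nv_n$ satisfies, for each $i$, $(v_{i-1},a_i,v_i)\in E$ or $(v_i,a_i^-,v_{i-1})\in E$;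 $\eta(\pi)=\eta(v_0)a_1\eta(v_1)\dots a_n\eta(v_n)$. A 2RDPQ over $\Sigma$ is $(x,L,y)$ with $L$ defined by an NRA or REM over $\Sigma^{\pm}$; a 2RRDPQ is $(x,L,y)$ with $L$ defined by an NRRA or RREM over the alphabet of symbols and their inverses. The evaluation result $\xi(\mathscr{G})$ is the set of pairs $(v,v')$ of nodes such that some semipath $\pi$ from $v$ to $v'$ has $\eta(\pi)\in L$. Data-to-node $k$-transformation $\mathscr{G}_{dn,k}=(V_{dn,k},E_{dn,k},\eta_{dn,k})$ (a data graph over $\Sigma\cup\{A_1,\dots,A_k\}$): $V_{dn,k}$ adds to $V$ a new node $n_v$ for each $v\in V$; $E_{dn,k}=E\cup\{(v,A_i,n_v)\mid v\in V,1\le i\le k\}$; $\eta_{dn,k}(v)=\eta_{dn,k}(n_v)=\eta(v)$ for $v\in V$. -}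

module Defs where

open import Data.Bool.Base using (if_then_else_)
open import Data.Empty using (⊥)
open import Data.Fin.Base using (Fin; zero; suc; toℕ; fromℕ; inject₁)
open import Data.Fin.Properties using (_≟_)
open import Data.List.Base using (List; []; _∷_)
open import Data.List.NonEmpty.Base using (List⁺; toList)
open import Data.List.Membership.Propositional using (_∈_; _∉_)
import Data.List.Membership.DecPropositional as DecMembership
open import Data.Maybe.Base using (Maybe; just; nothing)
open import Data.Nat.Base using (ℕ; zero; suc; _+_; _≤_; _<_)
open import Data.Product.Base using (_×_; _,_; ∃-syntax)
open import Data.Sum.Base using (_⊎_; inj₁; inj₂)
open import Data.Unit.Base using (⊤)
open import Data.Vec.Base using (Vec; []; _∷_; lookup)
open import Function.Bundles using (_↠_)
open import Level using (0ℓ)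
open import Relation.Binary.Construct.Closure.Transitive using (TransClosure)
open import Relation.Binary.Core using (Rel)
open import Relation.Binary.PropositionalEquality.Core using (_≡_; _≢_)
open import Relation.Nullary.Decidable.Core using (does)
open import Relation.Nullary.Negation.Core using (¬_)
open import Relation.Unary using (Pred)

Infinite : Set → Set
Infinite D = ∀ n → ¬ (Fin n ↠ D)

-- Finite sets that occur inside syntactic objects (transition relations, sets
-- of initial states, sets of registers, sets of letters) are given by lists
-- enumerating their elements; order and repetitions have no effect on the
-- semantics.

infixr 5 _−⟨_⟩→_

data Path (X Λ : Set) : Set where
  ⟨_⟩     : X → Path X Λ
  _−⟨_⟩→_ : X → Λ → Path X Λ → Path X Λ

module _ {X Λ : Set} where

  first last : Path X Λ → X
  first ⟨ x ⟩           = x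
  first (x −⟨ _ ⟩→ _)   = x
  last  ⟨ x ⟩           = x
  last  (_ −⟨ _ ⟩→ α)   = last α

  len : Path X Λ → ℕ
  len ⟨ _ ⟩         = 0
  len (_ −⟨ _ ⟩→ α) = suc (len α)

  -- An index i here stands for the position 2i of the sequence.
  Pos : Path X Λ → Set
  Pos α = Fin (suc (len α))

  value : (α : Path X Λ) → Pos α → X
  value ⟨ x ⟩         _       = x
  value (x −⟨ _ ⟩→ _) zero    = x
  value (_ −⟨ _ ⟩→ α) (suc i) = value α i

  -- letter α l is a_{l+1}: it stands between the indices inject₁ l and suc l.
  letter : (α : Path X Λ) → Fin (len α) → Λ
  letter (_ −⟨ a ⟩→ _) zero    = a
  letter (_ −⟨ _ ⟩→ α) (suc l) = letter α l

  -- Total, but meant only for last α ≡ first β.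
  _⋈_ : Path X Λ → Path X Λ → Path X Λ
  ⟨ _ ⟩         ⋈ β = β
  (x −⟨ a ⟩→ α) ⋈ β = x −⟨ a ⟩→ (α ⋈ β)

mapPath : {X Y Λ : Set} → (X → Y) → Path X Λ → Path Y Λ
mapPath f ⟨ x ⟩         = ⟨ f x ⟩
mapPath f (x −⟨ a ⟩→ α) = f x −⟨ a ⟩→ mapPath f α

infix  7 _∼_ _≁_
infixr 6 _∧_
infixr 5 _∨_

-- Index zero is r₀, the current data value; index suc i is a register.
data Constraint (k : ℕ) : Set where
  _∼_ _≁_ : (i j : Fin (suc k)) → .{i ≢ j} → Constraint k
  _∨_ _∧_ : Constraint k → Constraint k → Constraint k

Assignment : Set → ℕ → Set
Assignment D k = Fin k → Maybe D

module _ {D : Set} {k : ℕ} where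

  θ⊥ : Assignment D k
  θ⊥ _ = nothing

  _[_≔_] : Assignment D k → List (Fin k) → D → Assignment D k
  (θ [ X ≔ d ]) i = if does (i ∈? X) then just d else θ i
    where open DecMembership (_≟_ {k}) using (_∈?_)

  extend : Assignment D k → D → Fin (suc k) → Maybe D
  extend θ d zero    = just d
  extend θ d (suc i) = θ i

  SameValue : Assignment D k → D → Rel (Fin (suc k)) 0ℓ
  SameValue θ d i j =
    extend θ d i ≢ nothing × extend θ d j ≢ nothing × extend θ d i ≡ extend θ d j

  infix 4 _,_⊨_
  _,_⊨_ : Assignment D k → D → Constraint k → Set
  θ , d ⊨ (i ∼ j)  = SameValue θ d i j
  θ , d ⊨ (i ≁ j)  = ¬ SameValue θ d i j
  θ , d ⊨ (c ∨ c′) = θ , d ⊨ c ⊎ θ , d ⊨ c′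
  θ , d ⊨ (c ∧ c′) = θ , d ⊨ c × θ , d ⊨ c′

record NRA (Λ : Set) (k : ℕ) : Set where
  field
    nw nd : ℕ

  Qw : Set
  Qw = Fin nw

  Qd : Set
  Qd = Fin nd

  field
    δw : List (Qw × Λ × Qd)
    δd : List (Qd × Constraint k × Qw × List (Fin k))
    I  : List Qd
    F  : List Qw

module _ {D Λ : Set} {k : ℕ} (𝓐 : NRA Λ k) where
  open NRA 𝓐

  data AcceptsFrom : Qd → Assignment D k → Path D Λ → Set where
    stop : ∀ {q c q′ X θ d} →
           (q , c , q′ , X) ∈ δd → θ , d ⊨ c → q′ ∈ F →
           AcceptsFrom q θ ⟨ d ⟩
    step : ∀ {q c q′ X q″ θ d a α} →
           (q , c , q′ , X) ∈ δd → θ , d ⊨ c → (q′ , a , q″) ∈ δw →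
           AcceptsFrom q″ (θ [ X ≔ d ]) α →
           AcceptsFrom q θ (d −⟨ a ⟩→ α)

  NRA-Accepts : Path D Λ → Set
  NRA-Accepts α = ∃[ q ] q ∈ I × AcceptsFrom q θ⊥ α

data REM (Λ : Set) (k : ℕ) : Set where
  ε ∅     : REM Λ k
  sym     : Λ → REM Λ k
  _·_ _∪_ : REM Λ k → REM Λ k → REM Λ k
  _⁺      : REM Λ k → REM Λ k
  ↓       : List (Fin k) → REM Λ k → REM Λ k
  _⟦_⟧    : REM Λ k → Constraint k → REM Λ k

module _ {D Λ : Set} {k : ℕ} where

  -- θ ⊢⟨ e , α ⟩ θ′ is the relation written θ ⊢_{e,α} θ′.
  infix 4 _⊢⟨_,_⟩_
  data _⊢⟨_,_⟩_ : Assignment D k → REM Λ k → Path D Λ → Assignment D k → Set where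
    ε     : ∀ {θ d} → θ ⊢⟨ ε , ⟨ d ⟩ ⟩ θ
    sym   : ∀ {θ a d d′} → θ ⊢⟨ sym a , d −⟨ a ⟩→ ⟨ d′ ⟩ ⟩ θ
    cat   : ∀ {θ θ″ θ′ e₁ e₂ α α₁ α₂} → last α₁ ≡ first α₂ → α ≡ α₁ ⋈ α₂ →
            θ ⊢⟨ e₁ , α₁ ⟩ θ″ → θ″ ⊢⟨ e₂ , α₂ ⟩ θ′ →
            θ ⊢⟨ e₁ · e₂ , α ⟩ θ′
    left  : ∀ {θ θ′ e₁ e₂ α} → θ ⊢⟨ e₁ , α ⟩ θ′ → θ ⊢⟨ e₁ ∪ e₂ , α ⟩ θ′
    right : ∀ {θ θ′ e₁ e₂ α} → θ ⊢⟨ e₂ , α ⟩ θ′ → θ ⊢⟨ e₁ ∪ e₂ , α ⟩ θ′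
    once  : ∀ {θ θ′ e α} → θ ⊢⟨ e , α ⟩ θ′ → θ ⊢⟨ e ⁺ , α ⟩ θ′
    more  : ∀ {θ θ″ θ′ e α α₁ α₂} → last α₁ ≡ first α₂ → α ≡ α₁ ⋈ α₂ →
            θ ⊢⟨ e , α₁ ⟩ θ″ → θ″ ⊢⟨ e ⁺ , α₂ ⟩ θ′ →
            θ ⊢⟨ e ⁺ , α ⟩ θ′
    store : ∀ {θ θ′ X e α} → θ [ X ≔ first α ] ⊢⟨ e , α ⟩ θ′ → θ ⊢⟨ ↓ X e , α ⟩ θ′
    test  : ∀ {θ θ′ e c α} → θ ⊢⟨ e , α ⟩ θ′ → θ′ , last α ⊨ c →
            θ ⊢⟨ e ⟦ c ⟧ , α ⟩ θ′

  REM-Accepts : REM Λ k → Path D Λ → Set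
  REM-Accepts e α = ∃[ θ ] θ⊥ ⊢⟨ e , α ⟩ θ

data Op (Λ : Set) : Set where
  suc  pred  : Op Λ
  suc⟨_⟩ pred⟨_⟩ : List⁺ Λ → Op Λ

data Term (Λ : Set) : Set where
  cur : Term Λ
  _$_ : Op Λ → Term Λ → Term Λ

data RigidConstraint (Λ : Set) : Set where
  _∼_ _≁_ : Term Λ → Term Λ → RigidConstraint Λ
  _∨_ _∧_ : RigidConstraint Λ → RigidConstraint Λ → RigidConstraint Λ

module _ {D Λ : Set} (α : Path D Λ) where

  -- The partial functions on positions are given by their graphs; the value ⊥
  -- corresponds to an index related to no index.
  OpGraph : Op Λ → Rel (Pos α) 0ℓ
  OpGraph suc  i j = toℕ j ≡ suc (toℕ i)
  OpGraph pred i j = toℕ i ≡ suc (toℕ j)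
  OpGraph suc⟨ A ⟩ i j =
    ∃[ l ] j ≡ suc l × toℕ i ≤ toℕ l × letter α l ∈ toList A ×
           (∀ l′ → toℕ i ≤ toℕ l′ → toℕ l′ < toℕ l → letter α l′ ∉ toList A)
  OpGraph pred⟨ A ⟩ i j =
    ∃[ l ] j ≡ inject₁ l × toℕ l < toℕ i × letter α l ∈ toList A ×
           (∀ l′ → toℕ l < toℕ l′ → toℕ l′ < toℕ i → letter α l′ ∉ toList A)

  TermGraph : Term Λ → Rel (Pos α) 0ℓ
  TermGraph cur      i j = i ≡ j
  TermGraph (op $ t) i j = ∃[ i′ ] TermGraph t i i′ × OpGraph op i′ j

  SameValueAt : Pos α → Rel (Term Λ) 0ℓ
  SameValueAt i t₁ t₂ =
    ∃[ j₁ ] ∃[ j₂ ] TermGraph t₁ i j₁ × TermGraph t₂ i j₂ × value α j₁ ≡ value α j₂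

infix 4 _at_⊩_
_at_⊩_ : {D Λ : Set} (α : Path D Λ) → Pos α → RigidConstraint Λ → Set
α at i ⊩ (t₁ ∼ t₂) = SameValueAt α i t₁ t₂
α at i ⊩ (t₁ ≁ t₂) = ¬ SameValueAt α i t₁ t₂
α at i ⊩ (c ∨ c′)  = α at i ⊩ c ⊎ α at i ⊩ c′
α at i ⊩ (c ∧ c′)  = α at i ⊩ c × α at i ⊩ c′

record NRRA (Λ : Set) : Set where
  field
    nw nd : ℕ

  Qw : Set
  Qw = Fin nw

  Qd : Set
  Qd = Fin nd

  field
    δw : List (Qw × Λ × Qd)
    δd : List (Qd × RigidConstraint Λ × Qw)
    I  : List Qd
    F  : List Qw

module _ {D Λ : Set} (𝓐 : NRRA Λ) (α : Path D Λ) where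
  open NRRA 𝓐

  -- AcceptingRun i q: a suffix of an accepting run over the whole path α, in
  -- state q when the data value of index i is about to be read.
  data AcceptingRun : Pos α → Qd → Set where
    stop : ∀ {i q c q′} → i ≡ fromℕ (len α) →
           (q , c , q′) ∈ δd → α at i ⊩ c → q′ ∈ F →
           AcceptingRun i q
    step : ∀ {i l q c q′ q″} → i ≡ inject₁ l →
           (q , c , q′) ∈ δd → α at i ⊩ c → (q′ , letter α l , q″) ∈ δw →
           AcceptingRun (suc l) q″ →
           AcceptingRun i q

  NRRA-Accepts : Set
  NRRA-Accepts = ∃[ q ] q ∈ I × AcceptingRun zero q

data RREM (Λ : Set) : Set where
  ε       : RREM Λ
  sym     : Λ → RREM Λ
  test    : RigidConstraint Λ → RREM Λ
  _∪_ _·_ : RREM Λ → RREM Λ → RREM Λ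
  _⁺      : RREM Λ → RREM Λ

module _ {D Λ : Set} (α : Path D Λ) where

  Moves : RREM Λ → Rel (Pos α) 0ℓ
  Moves ε         i j = i ≡ j
  Moves (sym a)   i j = ∃[ l ] i ≡ inject₁ l × j ≡ suc l × letter α l ≡ a
  Moves (test c)  i j = i ≡ j × α at i ⊩ c
  Moves (e₁ ∪ e₂) i j = Moves e₁ i j ⊎ Moves e₂ i j
  Moves (e₁ · e₂) i j = ∃[ m ] Moves e₁ i m × Moves e₂ m j
  Moves (e ⁺)         = TransClosure (Moves e)

RREM-Accepts : {D Λ : Set} → RREM Λ → Path D Λ → Set
RREM-Accepts e α = Moves α e zero (fromℕ (len α))

data _± (A : Set) : Set where
  pos : A → A ±
  neg : A → A ±

record DataGraph (D Σ : Set) : Set₁ where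
  field
    V : Set
    E : V → Σ → V → Set
    η : V → D

  Traverses : V → Σ ± → V → Set
  Traverses u (pos a) v = E u a v
  Traverses u (neg a) v = E v a u

  IsSemipath : Path V (Σ ±) → Set
  IsSemipath ⟨ _ ⟩         = ⊤
  IsSemipath (v −⟨ a ⟩→ π) = Traverses v a (first π) × IsSemipath π

  Evaluation : Pred (Path D (Σ ±)) 0ℓ → Pred (V × V) 0ℓ
  Evaluation L (v , v′) =
    ∃[ π ] IsSemipath π × first π ≡ v × last π ≡ v′ × L (mapPath η π)

Var : Set
Var = ℕ

record 2RDPQ (Σ : Set) (k : ℕ) : Set where
  field
    x : Var
    L : NRA (Σ ±) k ⊎ REM (Σ ±) k
    y : Var

  Language : {D : Set} → Pred (Path D (Σ ±)) 0ℓ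
  Language with L
  ... | inj₁ 𝓐 = NRA-Accepts 𝓐
  ... | inj₂ e = REM-Accepts e

  evaluate : {D : Set} (𝓖 : DataGraph D Σ) → let open DataGraph 𝓖 in Pred (V × V) 0ℓ
  evaluate 𝓖 = DataGraph.Evaluation 𝓖 Language

record 2RRDPQ (Σ : Set) : Set where
  field
    x : Var
    L : NRRA (Σ ±) ⊎ RREM (Σ ±)
    y : Var

  Language : {D : Set} → Pred (Path D (Σ ±)) 0ℓ
  Language with L
  ... | inj₁ 𝓐 = NRRA-Accepts 𝓐
  ... | inj₂ e = RREM-Accepts e

  evaluate : {D : Set} (𝓖 : DataGraph D Σ) → let open DataGraph 𝓖 in Pred (V × V) 0ℓ
  evaluate 𝓖 = DataGraph.Evaluation 𝓖 Language

-- inj₁ a is a letter of Σ; inj₂ i is the new letter A_{i+1}.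
Σ+A : Set → ℕ → Set
Σ+A Σ k = Σ ⊎ Fin k

module _ {D Σ : Set} (𝓖 : DataGraph D Σ) (k : ℕ) where
  open DataGraph 𝓖

  data Vdn : Set where
    old  : V → Vdn
    node : V → Vdn

  data Edn : Vdn → Σ+A Σ k → Vdn → Set where
    old  : ∀ {u a v} → E u a v → Edn (old u) (inj₁ a) (old v)
    node : ∀ v i → Edn (old v) (inj₂ i) (node v)

  ηdn : Vdn → D
  ηdn (old v)  = η v
  ηdn (node v) = η v

  dataToNode : DataGraph D (Σ+A Σ k)
  dataToNode = record { V = Vdn ; E = Edn ; η = ηdn }

  -- A set of pairs over V, as a set of pairs over the larger set of nodes.
  embed : Pred (V × V) 0ℓ → Pred (Vdn × Vdn) 0ℓ
  embed S (p , q) = ∃[ u ] ∃[ v ] S (u , v) × p ≡ old u × q ≡ old v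

-- Programs are first-order, call-by-value and recursive, over binary trees.
-- Evaluation is charged one unit per step, plus the size of the tree for every
-- variable look-up, so the total cost bounds both the number of steps and the
-- size of every tree computed by an expression.  Hence polynomial cost in the
-- size of the input coincides with polynomial time on Turing machines.

infixr 5 _∙_

data Tree : Set where
  nil : Tree
  _∙_ : Tree → Tree → Tree

size : Tree → ℕ
size nil     = 1
size (s ∙ t) = suc (size s + size t)

-- f is the number of function symbols (all unary), n the number of variables
-- in scope (de Bruijn indices).  In  case e e₁ e₂  the branch e₂ binds the left
-- subtree as variable 0 and the right subtree as variable 1.
data Exp (f n : ℕ) : Set where
  var  : Fin n → Exp f n
  nil  : Exp f n
  _∙_  : Exp f n → Exp f n → Exp f n
  case : Exp f n → Exp f n → Exp f (2 + n) → Exp f n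
  bind : Exp f n → Exp f (1 + n) → Exp f n
  call : Fin f → Exp f n → Exp f n

record Program : Set where
  field
    funs : ℕ
    body : Vec (Exp funs 1) funs
    main : Exp funs 1

module _ (P : Program) where
  open Program P

  infix 4 _⊢_⇓_∣_
  data _⊢_⇓_∣_ {n : ℕ} (ρ : Vec Tree n) : Exp funs n → Tree → ℕ → Set where
    var   : ∀ i → ρ ⊢ var i ⇓ lookup ρ i ∣ suc (size (lookup ρ i))
    nil   : ρ ⊢ nil ⇓ nil ∣ 1
    _∙_   : ∀ {e₁ e₂ s t m₁ m₂} →
            ρ ⊢ e₁ ⇓ s ∣ m₁ → ρ ⊢ e₂ ⇓ t ∣ m₂ →
            ρ ⊢ e₁ ∙ e₂ ⇓ s ∙ t ∣ suc (m₁ + m₂)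
    case₁ : ∀ {e e₁ e₂ t m₁ m₂} →
            ρ ⊢ e ⇓ nil ∣ m₁ → ρ ⊢ e₁ ⇓ t ∣ m₂ →
            ρ ⊢ case e e₁ e₂ ⇓ t ∣ suc (m₁ + m₂)
    case₂ : ∀ {e e₁ e₂ l r t m₁ m₂} →
            ρ ⊢ e ⇓ l ∙ r ∣ m₁ → (l ∷ r ∷ ρ) ⊢ e₂ ⇓ t ∣ m₂ →
            ρ ⊢ case e e₁ e₂ ⇓ t ∣ suc (m₁ + m₂)
    bind  : ∀ {e e′ s t m₁ m₂} →
            ρ ⊢ e ⇓ s ∣ m₁ → (s ∷ ρ) ⊢ e′ ⇓ t ∣ m₂ →
            ρ ⊢ bind e e′ ⇓ t ∣ suc (m₁ + m₂)
    call  : ∀ {g e s t m₁ m₂} →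
            ρ ⊢ e ⇓ s ∣ m₁ → (s ∷ []) ⊢ lookup body g ⇓ t ∣ m₂ →
            ρ ⊢ call g e ⇓ t ∣ suc (m₁ + m₂)

_computes_↦_within_ : Program → Tree → Tree → ℕ → Set
P computes s ↦ t within m = ∃[ m′ ] m′ ≤ m × _⊢_⇓_∣_ P (s ∷ []) (Program.main P) t m′

-- Trees encode numbers in unary; alternatives are told apart by a numeric tag.
-- The number of registers and the alphabet are not recorded, so a time bound in
-- the size of the encoding does not depend on them.

record Encodable (A : Set) : Set where
  field
    encode : A → Tree

open Encodable ⦃ ... ⦄ public

encodeℕ : ℕ → Tree
encodeℕ zero    = nil
encodeℕ (suc n) = nil ∙ encodeℕ n

tag : ℕ → Tree → Tree
tag n t = encodeℕ n ∙ t

instance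
  Encodable-ℕ : Encodable ℕ
  Encodable-ℕ = record { encode = encodeℕ }

  Encodable-Fin : {n : ℕ} → Encodable (Fin n)
  Encodable-Fin = record { encode = λ i → encodeℕ (toℕ i) }

  Encodable-× : {A B : Set} → ⦃ Encodable A ⦄ → ⦃ Encodable B ⦄ → Encodable (A × B)
  Encodable-× = record { encode = λ (a , b) → encode a ∙ encode b }

  Encodable-⊎ : {A B : Set} → ⦃ Encodable A ⦄ → ⦃ Encodable B ⦄ → Encodable (A ⊎ B)
  Encodable-⊎ = record { encode = λ { (inj₁ a) → tag 0 (encode a)
                                    ; (inj₂ b) → tag 1 (encode b) } }

  Encodable-± : {A : Set} → ⦃ Encodable A ⦄ → Encodable (A ±)
  Encodable-± = record { encode = λ { (pos a) → tag 0 (encode a)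
                                    ; (neg a) → tag 1 (encode a) } }

encodeList : {A : Set} → ⦃ Encodable A ⦄ → List A → Tree
encodeList []       = nil
encodeList (a ∷ as) = encode a ∙ encodeList as

instance
  Encodable-List : {A : Set} → ⦃ Encodable A ⦄ → Encodable (List A)
  Encodable-List = record { encode = encodeList }

  Encodable-List⁺ : {A : Set} → ⦃ Encodable A ⦄ → Encodable (List⁺ A)
  Encodable-List⁺ = record { encode = λ as → encode (toList as) }

encodeConstraint : {k : ℕ} → Constraint k → Tree
encodeConstraint (i ∼ j)  = tag 0 (encode i ∙ encode j)
encodeConstraint (i ≁ j)  = tag 1 (encode i ∙ encode j)
encodeConstraint (c ∨ c′) = tag 2 (encodeConstraint c ∙ encodeConstraint c′)
encodeConstraint (c ∧ c′) = tag 3 (encodeConstraint c ∙ encodeConstraint c′)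

instance
  Encodable-Constraint : {k : ℕ} → Encodable (Constraint k)
  Encodable-Constraint = record { encode = encodeConstraint }

module _ {Λ : Set} ⦃ _ : Encodable Λ ⦄ where

  encodeOp : Op Λ → Tree
  encodeOp suc       = tag 0 nil
  encodeOp pred      = tag 1 nil
  encodeOp suc⟨ A ⟩  = tag 2 (encode A)
  encodeOp pred⟨ A ⟩ = tag 3 (encode A)

  encodeTerm : Term Λ → Tree
  encodeTerm cur      = nil
  encodeTerm (op $ t) = encodeOp op ∙ encodeTerm t

  encodeRigid : RigidConstraint Λ → Tree
  encodeRigid (t₁ ∼ t₂) = tag 0 (encodeTerm t₁ ∙ encodeTerm t₂)
  encodeRigid (t₁ ≁ t₂) = tag 1 (encodeTerm t₁ ∙ encodeTerm t₂)
  encodeRigid (c ∨ c′)  = tag 2 (encodeRigid c ∙ encodeRigid c′)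
  encodeRigid (c ∧ c′)  = tag 3 (encodeRigid c ∙ encodeRigid c′)

  encodeREM : {k : ℕ} → REM Λ k → Tree
  encodeREM ε         = tag 0 nil
  encodeREM ∅         = tag 1 nil
  encodeREM (sym a)   = tag 2 (encode a)
  encodeREM (e₁ · e₂) = tag 3 (encodeREM e₁ ∙ encodeREM e₂)
  encodeREM (e₁ ∪ e₂) = tag 4 (encodeREM e₁ ∙ encodeREM e₂)
  encodeREM (e ⁺)     = tag 5 (encodeREM e)
  encodeREM (↓ X e)   = tag 6 (encode X ∙ encodeREM e)
  encodeREM (e ⟦ c ⟧) = tag 7 (encodeREM e ∙ encode c)

  encodeRREM : RREM Λ → Tree
  encodeRREM ε         = tag 0 nil
  encodeRREM (sym a)   = tag 1 (encode a)
  encodeRREM (test c)  = tag 2 (encodeRigid c)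
  encodeRREM (e₁ ∪ e₂) = tag 3 (encodeRREM e₁ ∙ encodeRREM e₂)
  encodeRREM (e₁ · e₂) = tag 4 (encodeRREM e₁ ∙ encodeRREM e₂)
  encodeRREM (e ⁺)     = tag 5 (encodeRREM e)

  instance
    Encodable-Rigid : Encodable (RigidConstraint Λ)
    Encodable-Rigid = record { encode = encodeRigid }

    Encodable-REM : {k : ℕ} → Encodable (REM Λ k)
    Encodable-REM = record { encode = encodeREM }

    Encodable-RREM : Encodable (RREM Λ)
    Encodable-RREM = record { encode = encodeRREM }

    Encodable-NRA : {k : ℕ} → Encodable (NRA Λ k)
    Encodable-NRA = record { encode = λ 𝓐 → let open NRA 𝓐 in
      encode (nw , nd , δw , δd , I , F) }

    Encodable-NRRA : Encodable (NRRA Λ)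
    Encodable-NRRA = record { encode = λ 𝓐 → let open NRRA 𝓐 in
      encode (nw , nd , δw , δd , I , F) }

instance
  Encodable-2RDPQ : {Σ : Set} {k : ℕ} → ⦃ Encodable Σ ⦄ → Encodable (2RDPQ Σ k)
  Encodable-2RDPQ = record { encode = λ ξ → let open 2RDPQ ξ in encode (x , L , y) }

  Encodable-2RRDPQ : {Σ : Set} → ⦃ Encodable Σ ⦄ → Encodable (2RRDPQ Σ)
  Encodable-2RRDPQ = record { encode = λ ξ → let open 2RRDPQ ξ in encode (x , L , y) }

{-# OPTIONS --safe #-}

-- A data value is stored in register i by the detour v, n_v, v along A_i and
-- back; since both ends of A_i carry the current value, the content of register
-- i is afterwards the value at pred_{A_i}(cur), and this term is undefined as
-- long as the register is empty.  Register constraints thus become rigid ones,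
-- and only A_i itself, not its inverse, counts as a store.  Every query ends
-- with a further detour along A_1, which excludes paths of the extended graph
-- that start or end at a new node n_v.
--
-- For an expression, ↓_X becomes a sequence of detours.  For an automaton, the
-- detours need states; instead of remembering which registers of X have been
-- served, each transition gets a loop that makes detours for registers of X at
-- will, and may be left only if pred_{A_x}(cur) ∼ cur holds for all x in X.
-- Hence a constant number of states per transition suffices.
--
-- The translation is carried out by a program that makes linearly many calls,
-- each with an argument of linear size, so its cost is quadratic.

module Submission where

open import Data.Empty using (⊥)
open import Data.Fin using (#_)
open import Data.Fin.Base using (Fin; zero; suc; toℕ; fromℕ; inject₁; inject≤; _↑ˡ_; _↑ʳ_; combine)
import Data.Fin.Properties as Fin
open import Data.List.Base using (List; []; _∷_; _++_; map; length; lookup)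
open import Data.List.Membership.Propositional using (_∈_; _∉_)
open import Data.List.Membership.Propositional.Properties
  using (∈-++⁺ˡ; ∈-++⁺ʳ; ∈-++⁻; ∈-map⁺; ∈-map⁻; ∈-lookup)
import Data.List.Membership.DecPropositional as DecMembership
open import Data.List.NonEmpty.Base using (_∷_)
open import Data.List.Relation.Unary.Any using (here; there; index)
open import Data.List.Relation.Unary.Any.Properties using (lookup-index)
open import Data.Maybe.Base using (just; nothing)
open import Data.Maybe.Properties using (just-injective)
open import Data.Nat.Base
  using (ℕ; zero; suc; _+_; _*_; _^_; _≤_; _<_; z≤n; s≤s)
open import Data.Nat.Properties
open import Data.Nat.Tactic.RingSolver using (solve-∀)
open import Data.Product.Base using (_×_; _,_; ∃-syntax; Σ-syntax; proj₁; proj₂)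
open import Data.Sum.Base as Sum using (_⊎_; inj₁; inj₂)
open import Data.Unit.Base using (⊤; tt)
open import Data.Vec.Base as Vec using (Vec; []; _∷_)
open import Function.Base using (_∘_; _∋_)
open import Level using (0ℓ)
open import Relation.Binary.Construct.Closure.Transitive using (TransClosure; [_]; _∷_)
open import Relation.Binary.Core using (Rel)
open import Relation.Binary.PropositionalEquality
  using (_≡_; _≢_; refl; trans; cong; cong₂; subst) renaming (sym to ≡-sym)
open import Relation.Nullary using (¬_; yes; no; contradiction)
open import Relation.Unary using (_≐_)
open import Defs

-- A rigid constraint may look anywhere on the path, which obstructs induction along it. The
-- constraints produced here contain only `cur` and `pred` of a single mark applied to `cur`. Their
-- truth depends on the current value and on what was last stored, so a position can be replaced by
-- a register assignment together with the remaining path. Since negated tests occur too, this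
-- replacement must be exact in both directions.
--
-- The second obstacle is that the extended graph has more paths than the original one. Letters of
-- `Σ` join old nodes only, and every edge at the new node of `v` connects it with `v`. Hence a new
-- node in the interior of a path lies between two visits of the same old node, and only the two
-- ends are in doubt.
--
-- Registers may be fewer than marks (`r ≤ k`); register `x` uses mark `x`. The program has no
-- append: each generator of letter rules ends by calling the next one, and the new states are
-- numbered by two counters handed along.

-- Register updates and transitive closures.

module _ {D : Set} {k : ℕ} where
  open DecMembership (Fin._≟_ {k}) using (_∈?_)

  assign-∈ : ∀ (θ : Assignment D k) X {d x} → x ∈ X → (θ [ X ≔ d ]) x ≡ just d
  assign-∈ θ X {d} {x} x∈X with x ∈? X
  ... | yes _   = refl
  ... | no  x∉X = contradiction x∈X x∉X

  assign-∉ : ∀ (θ : Assignment D k) X {d x} → x ∉ X → (θ [ X ≔ d ]) x ≡ θ x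
  assign-∉ θ X {d} {x} x∉X with x ∈? X
  ... | yes x∈X = contradiction x∈X x∉X
  ... | no  _   = refl

module _ {A B : Set} {R : Rel A 0ℓ} {S : Rel B 0ℓ} (f : A → B) where

  closure-map : (∀ {x y} → R x y → S (f x) (f y)) →
                ∀ {x y} → TransClosure R x y → TransClosure S (f x) (f y)
  closure-map h [ r ]    = [ h r ]
  closure-map h (r ∷ rs) = h r ∷ closure-map h rs

  -- Only the starting point needs to lie in the image of `f`: the hypothesis pulls each next point
  -- back before the following step is taken. In the application `f` is `config θ⊥ β`, which is not
  -- surjective.
  closure-lift : (∀ {x z} → S (f x) z → ∃[ y ] z ≡ f y × R x y) →
                 ∀ {x z} → TransClosure S (f x) z → ∃[ y ] z ≡ f y × TransClosure R x y
  closure-lift h [ s ] with h s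
  ... | y , eq , r = y , eq , [ r ]
  closure-lift h (s ∷ ss) with h s
  ... | y , refl , r with closure-lift h ss
  ... | y′ , eq , rs = y′ , eq , r ∷ rs

-- From positions and rigid constraints to configurations.

-- Traversing A_i is the instruction to store the current data value in register i.
module Tracking {Σ D : Set} (k : ℕ) where

  Letter : Set
  Letter = Σ+A Σ k ±

  track : Assignment D k → Letter → D → Assignment D k
  track θ (pos (inj₂ x)) d = θ [ x ∷ [] ≔ d ]
  track θ (pos (inj₁ _)) d = θ
  track θ (neg _)        d = θ

  -- Registers and current value determine the two shapes of term that the translation produces.
  -- Other terms would need the whole path and get a default; `LocalTerm` confines the later lemmas
  -- to the two shapes.
  TermValue : Assignment D k → D → Term Letter → D → Set
  TermValue θ d cur                               v = v ≡ d
  TermValue θ d (pred⟨ pos (inj₂ x) ∷ [] ⟩ $ cur) v = θ x ≡ just v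
  TermValue θ d _                                 v = ⊥

  data LocalTerm : Term Letter → Set where
    cur  : LocalTerm cur
    lastMark : ∀ x → LocalTerm (pred⟨ pos (inj₂ x) ∷ [] ⟩ $ cur)

  Equal : Assignment D k → D → Term Letter → Term Letter → Set
  Equal θ d t₁ t₂ = ∃[ v ] TermValue θ d t₁ v × TermValue θ d t₂ v

  Satisfies : Assignment D k → D → RigidConstraint Letter → Set
  Satisfies θ d (t₁ ∼ t₂) = Equal θ d t₁ t₂
  Satisfies θ d (t₁ ≁ t₂) = ¬ Equal θ d t₁ t₂
  Satisfies θ d (c ∨ c′)  = Satisfies θ d c ⊎ Satisfies θ d c′
  Satisfies θ d (c ∧ c′)  = Satisfies θ d c × Satisfies θ d c′

  Local : RigidConstraint Letter → Set
  Local (t₁ ∼ t₂) = LocalTerm t₁ × LocalTerm t₂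
  Local (t₁ ≁ t₂) = LocalTerm t₁ × LocalTerm t₂
  Local (c ∨ c′)  = Local c × Local c′
  Local (c ∧ c′)  = Local c × Local c′

  LocalRREM : RREM Letter → Set
  LocalRREM ε         = ⊤
  LocalRREM (sym _)   = ⊤
  LocalRREM (test c)  = Local c
  LocalRREM (e₁ ∪ e₂) = LocalRREM e₁ × LocalRREM e₂
  LocalRREM (e₁ · e₂) = LocalRREM e₁ × LocalRREM e₂
  LocalRREM (e ⁺)     = LocalRREM e

  -- A configuration records the registers and the part of the path still to be
  -- traversed; it is what a position amounts to for local constraints.
  module _ {X : Set} (η : X → D) where

    Config : Set
    Config = Assignment D k × Path X Letter

    data Step (a : Letter) : Rel Config 0ℓ where
      step : ∀ {θ x β} → Step a (θ , x −⟨ a ⟩→ β) (track θ a (η x) , β)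

    Passes : RREM Letter → Rel Config 0ℓ
    Passes ε         κ κ′ = κ ≡ κ′
    Passes (sym a)        = Step a
    Passes (test c)  κ κ′ = κ ≡ κ′ × Satisfies (proj₁ κ) (η (first (proj₂ κ))) c
    Passes (e₁ ∪ e₂) κ κ′ = Passes e₁ κ κ′ ⊎ Passes e₂ κ κ′
    Passes (e₁ · e₂) κ κ′ = ∃[ κ″ ] Passes e₁ κ κ″ × Passes e₂ κ″ κ′
    Passes (e ⁺)          = TransClosure (Passes e)

    -- The initial assignment is a parameter because the recursion hands the updated registers on to
    -- the rest of the path.
    config : Assignment D k → (β : Path X Letter) → Pos (mapPath η β) → Config
    config θ β             zero    = θ , β
    config θ (x −⟨ a ⟩→ β) (suc i) = config (track θ a (η x)) β i

    config-step : ∀ θ β l → let α = mapPath η β in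
      Step (letter α l) (config θ β (inject₁ l)) (config θ β (suc l))
    config-step θ (x −⟨ a ⟩→ β) zero    = step
    config-step θ (x −⟨ a ⟩→ β) (suc l) = config-step _ β l

    config-step⁻¹ : ∀ θ β i {a κ} → let α = mapPath η β in
      Step a (config θ β i) κ →
      ∃[ l ] i ≡ inject₁ l × letter α l ≡ a × κ ≡ config θ β (suc l)
    config-step⁻¹ θ (x −⟨ a ⟩→ β) zero    step = zero , refl , refl , refl
    config-step⁻¹ θ (x −⟨ a ⟩→ β) (suc i) s with config-step⁻¹ _ β i s
    ... | l , refl , eq , eq′ = suc l , refl , eq , eq′

    config-last : ∀ θ β → ∃[ θ′ ] config θ β (fromℕ (len (mapPath η β))) ≡ (θ′ , ⟨ last β ⟩)
    config-last θ ⟨ x ⟩         = θ , refl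
    config-last θ (x −⟨ a ⟩→ β) = config-last _ β

    -- The remaining path gets shorter with every index, so a single remaining node identifies the
    -- last position. This is how acceptance is recovered from a configuration.
    config-last⁻¹ : ∀ θ β i {θ′ x} → config θ β i ≡ (θ′ , ⟨ x ⟩) →
                    i ≡ fromℕ (len (mapPath η β))
    config-last⁻¹ θ ⟨ x ⟩         zero    eq = refl
    config-last⁻¹ θ (x −⟨ a ⟩→ β) (suc i) eq = cong suc (config-last⁻¹ _ β i eq)

    config-value : ∀ θ β i → value (mapPath η β) i ≡ η (first (proj₂ (config θ β i)))
    config-value θ ⟨ x ⟩         zero    = refl
    config-value θ (x −⟨ a ⟩→ β) zero    = refl
    config-value θ (x −⟨ a ⟩→ β) (suc i) = config-value _ β i

    ValueAtMark : Path X Letter → Fin k → D → (β : Path X Letter) → Pos (mapPath η β) → Set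
    ValueAtMark _ x d β i = ∃[ j ] OpGraph α pred⟨ pos (inj₂ x) ∷ [] ⟩ i j × value α j ≡ d
      where α = mapPath η β

    Unmarked : Fin k → (β : Path X Letter) → Pos (mapPath η β) → Set
    Unmarked x β i = ∀ l → toℕ l < toℕ i → letter (mapPath η β) l ∉ pos (inj₂ x) ∷ []

    track-marked : ∀ θ x d → track θ (pos (inj₂ x)) d x ≡ just d
    track-marked θ x d = assign-∈ θ (x ∷ []) (here refl)

    track-unmarked : ∀ θ {x} a d → a ∉ pos (inj₂ x) ∷ [] → track θ a d x ≡ θ x
    track-unmarked θ (pos (inj₁ _)) d a∉ = refl
    track-unmarked θ (neg _)        d a∉ = refl
    track-unmarked θ (pos (inj₂ y)) d a∉ =
      assign-∉ θ (y ∷ []) λ where (here refl) → a∉ (here refl)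

    marked? : ∀ x (a : Letter) → a ∈ pos (inj₂ x) ∷ [] ⊎ a ∉ pos (inj₂ x) ∷ []
    marked? x (pos (inj₁ _)) = inj₂ λ where (here ())
    marked? x (neg _)        = inj₂ λ where (here ())
    marked? x (pos (inj₂ y)) with x Fin.≟ y
    ... | yes refl = inj₁ (here refl)
    ... | no  x≢y  = inj₂ λ where (here refl) → x≢y refl

    -- A register holds what its last mark wrote or, without such a mark, its initial content. The
    -- second alternative is there for the induction, where the rest of the path may start with
    -- filled registers.
    config-register : ∀ θ β i x d → proj₁ (config θ β i) x ≡ just d →
      ValueAtMark β x d β i ⊎ (Unmarked x β i × θ x ≡ just d)
    config-register θ β zero x d eq = inj₂ ((λ _ ()) , eq)
    config-register θ (y −⟨ a ⟩→ β) (suc i) x d eq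
      with config-register (track θ a (η y)) β i x d eq
    ... | inj₁ (_ , (l , refl , l<i , l∈ , none) , val) =
      inj₁ (_ , (suc l , refl , s≤s l<i , l∈ , none′) , val)
      where
      none′ : ∀ l′ → suc (toℕ l) < toℕ l′ → toℕ l′ < suc (toℕ i) →
              letter (mapPath η (y −⟨ a ⟩→ β)) l′ ∉ pos (inj₂ x) ∷ []
      none′ (suc l′) (s≤s p) (s≤s q) = none l′ p q
    ... | inj₂ (none , eq′) with marked? x a
    ...   | inj₁ (here refl) =
      -- No mark for `x` occurs among the later letters before the position, so the first letter is
      -- the last mark and the first node supplies the value.
      inj₁ (zero , (zero , refl , s≤s z≤n , here refl , none′) ,
            just-injective (trans (≡-sym (track-marked θ x (η y))) eq′))
      where
      none′ : ∀ l′ → 0 < toℕ l′ → toℕ l′ < suc (toℕ i) →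
              letter (mapPath η (y −⟨ a ⟩→ β)) l′ ∉ pos (inj₂ x) ∷ []
      none′ (suc l′) _ (s≤s q) = none l′ q
    ...   | inj₂ a∉ = inj₂ (none′ , trans (≡-sym (track-unmarked θ a (η y) a∉)) eq′)
      where
      none′ : Unmarked x (y −⟨ a ⟩→ β) (suc i)
      none′ zero     _       = a∉
      none′ (suc l′) (s≤s q) = none l′ q

    config-register⁻¹ : ∀ θ β i x d →
      ValueAtMark β x d β i ⊎ (Unmarked x β i × θ x ≡ just d) →
      proj₁ (config θ β i) x ≡ just d
    config-register⁻¹ θ β zero x d (inj₂ (_ , eq)) = eq
    config-register⁻¹ θ β zero x d (inj₁ (_ , (_ , _ , () , _) , _))
    config-register⁻¹ θ (y −⟨ a ⟩→ β) (suc i) x d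
                      (inj₁ (_ , (zero , refl , _ , here refl , none) , refl)) =
      config-register⁻¹ _ β i x d
        (inj₂ ((λ l l<i → none (suc l) (s≤s z≤n) (s≤s l<i)) , track-marked θ x _))
    config-register⁻¹ θ (y −⟨ a ⟩→ β) (suc i) x d
                      (inj₁ (_ , (suc l , refl , s≤s l<i , l∈ , none) , val)) =
      config-register⁻¹ _ β i x d
        (inj₁ (_ , (l , refl , l<i , l∈ , λ l′ p q → none (suc l′) (s≤s p) (s≤s q)) , val))
    config-register⁻¹ θ (y −⟨ a ⟩→ β) (suc i) x d (inj₂ (none , eq)) =
      config-register⁻¹ _ β i x d
        (inj₂ ((λ l l<i → none (suc l) (s≤s l<i)) ,
               trans (track-unmarked θ a (η y) (none zero (s≤s z≤n))) eq))

    module _ (β : Path X Letter) where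
      private
        α = mapPath η β

        registers : Pos α → Assignment D k
        registers i = proj₁ (config θ⊥ β i)

        current : Pos α → D
        current i = η (first (proj₂ (config θ⊥ β i)))

      termValue : ∀ {t} → LocalTerm t → ∀ {i j} → TermGraph α t i j →
                  TermValue (registers i) (current i) t (value α j)
      termValue cur {i} refl = config-value θ⊥ β i
      termValue (lastMark x) {i} (_ , refl , g) =
        config-register⁻¹ θ⊥ β i x _ (inj₁ (_ , g , refl))

      termValue⁻¹ : ∀ {t} → LocalTerm t → ∀ {i v} →
                    TermValue (registers i) (current i) t v →
                    ∃[ j ] TermGraph α t i j × value α j ≡ v
      termValue⁻¹ cur {i} refl = i , refl , config-value θ⊥ β i
      termValue⁻¹ (lastMark x) {i} {v} eq with config-register θ⊥ β i x v eq
      -- The other alternative would make a register of `θ⊥` equal to `just v`.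
      ... | inj₁ (j , g , val) = j , (_ , refl , g) , val

      equal : ∀ {t₁ t₂} → LocalTerm t₁ → LocalTerm t₂ → ∀ {i} →
              SameValueAt α i t₁ t₂ → Equal (registers i) (current i) t₁ t₂
      equal l₁ l₂ (_ , _ , g₁ , g₂ , eq) =
        _ , termValue l₁ g₁ , subst (TermValue _ _ _) (≡-sym eq) (termValue l₂ g₂)

      equal⁻¹ : ∀ {t₁ t₂} → LocalTerm t₁ → LocalTerm t₂ → ∀ {i} →
                Equal (registers i) (current i) t₁ t₂ → SameValueAt α i t₁ t₂
      equal⁻¹ l₁ l₂ (v , v₁ , v₂) with termValue⁻¹ l₁ v₁ | termValue⁻¹ l₂ v₂
      ... | _ , g₁ , eq₁ | _ , g₂ , eq₂ = _ , _ , g₁ , g₂ , trans eq₁ (≡-sym eq₂)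

      satisfies   : ∀ c → Local c → ∀ {i} →
                    α at i ⊩ c → Satisfies (registers i) (current i) c
      satisfies⁻¹ : ∀ c → Local c → ∀ {i} →
                    Satisfies (registers i) (current i) c → α at i ⊩ c
      satisfies (t₁ ∼ t₂) (l₁ , l₂) s        = equal l₁ l₂ s
      satisfies (t₁ ≁ t₂) (l₁ , l₂) s        = λ s′ → s (equal⁻¹ l₁ l₂ s′)
      satisfies (c ∨ c′)  (l , l′) (inj₁ s)  = inj₁ (satisfies c l s)
      satisfies (c ∨ c′)  (l , l′) (inj₂ s)  = inj₂ (satisfies c′ l′ s)
      satisfies (c ∧ c′)  (l , l′) (s , s′)  = satisfies c l s , satisfies c′ l′ s′
      satisfies⁻¹ (t₁ ∼ t₂) (l₁ , l₂) s       = equal⁻¹ l₁ l₂ s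
      satisfies⁻¹ (t₁ ≁ t₂) (l₁ , l₂) s       = λ s′ → s (equal l₁ l₂ s′)
      satisfies⁻¹ (c ∨ c′)  (l , l′) (inj₁ s) = inj₁ (satisfies⁻¹ c l s)
      satisfies⁻¹ (c ∨ c′)  (l , l′) (inj₂ s) = inj₂ (satisfies⁻¹ c′ l′ s)
      satisfies⁻¹ (c ∧ c′)  (l , l′) (s , s′) = satisfies⁻¹ c l s , satisfies⁻¹ c′ l′ s′

      passes : ∀ e → LocalRREM e → ∀ {i j} →
               Moves α e i j → Passes e (config θ⊥ β i) (config θ⊥ β j)
      passes ε         _       refl                     = refl
      passes (sym a)   _       (l , refl , refl , refl) = config-step θ⊥ β l
      passes (test c)  l       (refl , s)               = refl , satisfies c l s
      passes (e₁ ∪ e₂) (l , _) (inj₁ m)                 = inj₁ (passes e₁ l m)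
      passes (e₁ ∪ e₂) (_ , l) (inj₂ m)                 = inj₂ (passes e₂ l m)
      passes (e₁ · e₂) (l₁ , l₂) (_ , m₁ , m₂)          = _ , passes e₁ l₁ m₁ , passes e₂ l₂ m₂
      passes (e ⁺)     l       ms                       = closure-map (config θ⊥ β) (passes e l) ms

      -- The target configuration is arbitrary, and that it belongs to some position is part of the
      -- conclusion. Composition and closure depend on this for their intermediate configurations.
      passes⁻¹ : ∀ e → LocalRREM e → ∀ {i κ} → Passes e (config θ⊥ β i) κ →
                 ∃[ j ] κ ≡ config θ⊥ β j × Moves α e i j
      passes⁻¹ ε         _       refl       = _ , refl , refl
      passes⁻¹ (sym a)   _       {i} s with config-step⁻¹ θ⊥ β i s
      ... | l , eq , eq′ , refl = suc l , refl , l , eq , refl , eq′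
      passes⁻¹ (test c)  l       (refl , s) = _ , refl , refl , satisfies⁻¹ c l s
      passes⁻¹ (e₁ ∪ e₂) (l , _) (inj₁ p) with passes⁻¹ e₁ l p
      ... | j , eq , m = j , eq , inj₁ m
      passes⁻¹ (e₁ ∪ e₂) (_ , l) (inj₂ p) with passes⁻¹ e₂ l p
      ... | j , eq , m = j , eq , inj₂ m
      passes⁻¹ (e₁ · e₂) (l₁ , l₂) (_ , p₁ , p₂) with passes⁻¹ e₁ l₁ p₁
      ... | _ , refl , m₁ with passes⁻¹ e₂ l₂ p₂
      ...   | j , eq , m₂ = j , eq , _ , m₁ , m₂
      passes⁻¹ (e ⁺)     l       ps = closure-lift (config θ⊥ β) (passes⁻¹ e l) ps

      accepts⇒passes : ∀ e → LocalRREM e → RREM-Accepts e α →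
                       ∃[ θ ] Passes e (θ⊥ , β) (θ , ⟨ last β ⟩)
      accepts⇒passes e l m =
        proj₁ (config-last θ⊥ β) ,
        subst (Passes e (θ⊥ , β)) (proj₂ (config-last θ⊥ β)) (passes e l m)

      passes⇒accepts : ∀ e → LocalRREM e → ∀ {θ x} →
                       Passes e (θ⊥ , β) (θ , ⟨ x ⟩) → RREM-Accepts e α
      passes⇒accepts e l p with passes⁻¹ e l {zero} p
      ... | j , eq , m = subst (Moves α e zero) (config-last⁻¹ θ⊥ β j (≡-sym eq)) m

    module _ (𝓑 : NRRA Letter) where
      open NRRA 𝓑

      -- Accepting runs on configurations, split by the kind of state, so that the test on a value
      -- is separated from the choice between stopping and reading a letter.
      data ReadsValue  : Qd → Config → Set
      data ReadsLetter : Qw → Config → Set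

      data ReadsValue where
        readValue : ∀ {q c q′ θ β} → (q , c , q′) ∈ δd → Satisfies θ (η (first β)) c →
                ReadsLetter q′ (θ , β) → ReadsValue q (θ , β)

      data ReadsLetter where
        stop : ∀ {q θ x} → q ∈ F → ReadsLetter q (θ , ⟨ x ⟩)
        readLetter : ∀ {q a q′ θ x β} → (q , a , q′) ∈ δw →
                 ReadsValue q′ (track θ a (η x) , β) →
                 ReadsLetter q (θ , x −⟨ a ⟩→ β)

      module _ (local : ∀ {q c q′} → (q , c , q′) ∈ δd → Local c) (β : Path X Letter) where
        private
          α = mapPath η β

        reads : ∀ {i q} → AcceptingRun 𝓑 α i q → ReadsValue q (config θ⊥ β i)
        reads (stop {c = c} refl t s f) =
          readValue t (satisfies β c (local t) s)
            (subst (ReadsLetter _) (≡-sym (proj₂ (config-last θ⊥ β))) (stop f))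
        reads (step {l = l} {c = c} {q′ = q′} refl t s t′ r) =
          readValue t (satisfies β c (local t) s) (next (config-step θ⊥ β l) t′ (reads r))
          where
          next : ∀ {a κ κ′ q″} → Step a κ κ′ → (q′ , a , q″) ∈ δw →
                 ReadsValue q″ κ′ → ReadsLetter q′ κ
          next step t r = readLetter t r

        -- The configuration is a variable tied to `i` by an equation: matching on the run fixes the
        -- shape of the remaining path, which does not unify with `config θ⊥ β i`.
        reads⁻¹ : ∀ {i q κ} → κ ≡ config θ⊥ β i → ReadsValue q κ → AcceptingRun 𝓑 α i q
        reads⁻¹ {i} eq (readValue {c = c} t s (stop f)) =
          stop (config-last⁻¹ θ⊥ β i (≡-sym eq)) t
               (satisfies⁻¹ β c (local t) (subst (λ κ → Satisfies (proj₁ κ) (η (first (proj₂ κ))) c) eq s)) f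
        reads⁻¹ {i} eq (readValue {c = c} t s (readLetter {a = a} {θ = θ} {x} {β′} t′ r))
          with config-step⁻¹ θ⊥ β i (subst (λ κ → Step a κ (track θ a (η x) , β′)) eq step)
        ... | l , refl , refl , eq′ =
          step refl t
               (satisfies⁻¹ β c (local t) (subst (λ κ → Satisfies (proj₁ κ) (η (first (proj₂ κ))) c) eq s))
               t′ (reads⁻¹ eq′ r)

-- Expressions with memory

module _ {X Λ : Set} where

  first-⋈ : (α : Path X Λ) {β : Path X Λ} → last α ≡ first β → first (α ⋈ β) ≡ first α
  first-⋈ ⟨ x ⟩         eq = ≡-sym eq
  first-⋈ (x −⟨ a ⟩→ α) eq = refl

  last-⋈ : (α β : Path X Λ) → last (α ⋈ β) ≡ last β
  last-⋈ ⟨ x ⟩         β = refl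
  last-⋈ (x −⟨ a ⟩→ α) β = last-⋈ α β

module _ {X Y Λ : Set} (f : X → Y) where

  first-map : (π : Path X Λ) → first (mapPath f π) ≡ f (first π)
  first-map ⟨ x ⟩         = refl
  first-map (x −⟨ a ⟩→ π) = refl

  last-map : (π : Path X Λ) → last (mapPath f π) ≡ f (last π)
  last-map ⟨ x ⟩         = refl
  last-map (x −⟨ a ⟩→ π) = last-map π

  map-⋈ : (π ρ : Path X Λ) → mapPath f (π ⋈ ρ) ≡ mapPath f π ⋈ mapPath f ρ
  map-⋈ ⟨ x ⟩         ρ = refl
  map-⋈ (x −⟨ a ⟩→ π) ρ = cong (f x −⟨ a ⟩→_) (map-⋈ π ρ)

  -- Data values do not determine nodes, so the cut is made by length: `π` is cut after as many
  -- letters as `α` has, and both pieces keep the node at the cut.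
  split-map : ∀ (α : Path Y Λ) {β} (π : Path X Λ) →
              α ⋈ β ≡ mapPath f π → last α ≡ first β →
              ∃[ ρ ] ∃[ σ ] π ≡ ρ ⋈ σ × α ≡ mapPath f ρ × β ≡ mapPath f σ × last ρ ≡ first σ
  split-map ⟨ y ⟩ π refl eq =
    ⟨ first π ⟩ , π , refl , cong ⟨_⟩ (trans eq (first-map π)) , refl , refl
  split-map (y −⟨ b ⟩→ α) (x −⟨ a ⟩→ π) eq eq′ with uncons eq
    where
    uncons : ∀ {y y′ : Y} {a a′ : Λ} {α α′} →
             y −⟨ a ⟩→ α ≡ y′ −⟨ a′ ⟩→ α′ → y ≡ y′ × a ≡ a′ × α ≡ α′
    uncons refl = refl , refl , refl
  ... | refl , refl , eq″ with split-map α π eq″ eq′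
  ... | ρ , σ , refl , refl , refl , eq‴ =
    x −⟨ a ⟩→ ρ , σ , refl , refl , refl , eq‴

module _ {D Σ : Set} (𝓖 : DataGraph D Σ) where
  open DataGraph 𝓖

  semipath-⋈ : ∀ π {ρ} → last π ≡ first ρ → IsSemipath π → IsSemipath ρ → IsSemipath (π ⋈ ρ)
  semipath-⋈ ⟨ x ⟩         eq p       q = q
  semipath-⋈ (x −⟨ a ⟩→ π) eq (t , p) q =
    subst (Traverses x a) (≡-sym (first-⋈ π eq)) t , semipath-⋈ π eq p q

  semipath-⋈⁻¹ : ∀ π {ρ} → last π ≡ first ρ → IsSemipath (π ⋈ ρ) → IsSemipath π × IsSemipath ρ
  semipath-⋈⁻¹ ⟨ x ⟩         eq p       = tt , p
  semipath-⋈⁻¹ (x −⟨ a ⟩→ π) eq (t , p) with semipath-⋈⁻¹ π eq p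
  ... | q , q′ = (subst (Traverses x a) (first-⋈ π eq) t , q) , q′

-- The alphabet has k = suc k′ marks, of which the r registers use the first r.
module Translation {Σ : Set} {r k′ : ℕ} (r≤k : r ≤ suc k′) where

  k : ℕ
  k = suc k′

  Letter : Set
  Letter = Σ+A Σ k ±

  liftLetter : Σ ± → Letter
  liftLetter (pos a) = pos (inj₁ a)
  liftLetter (neg a) = neg (inj₁ a)

  mark : Fin r → Letter
  mark x = pos (inj₂ (inject≤ x r≤k))

  -- All marks from `v` to its new node are parallel, so the inverse of the first one leads back
  -- from every detour, whichever mark opened it. That this mark exists is where `k ≥ 1` enters.
  enter leave : Letter
  enter = pos (inj₂ zero)
  leave = neg (inj₂ zero)

  term : Fin (suc r) → Term Letter
  term zero    = cur
  term (suc x) = pred⟨ mark x ∷ [] ⟩ $ cur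

  rigid : Constraint r → RigidConstraint Letter
  rigid (i ∼ j)  = term i ∼ term j
  rigid (i ≁ j)  = term i ≁ term j
  rigid (c ∨ c′) = rigid c ∨ rigid c′
  rigid (c ∧ c′) = rigid c ∧ rigid c′

  always : RigidConstraint Letter
  always = cur ∼ cur

  stored : List (Fin r) → RigidConstraint Letter
  stored []      = always
  stored (x ∷ X) = (term (suc x) ∼ cur) ∧ stored X

  storing : List (Fin r) → RREM Letter
  storing []      = ε
  storing (x ∷ X) = (sym (mark x) · sym leave) · storing X

  rrem : REM (Σ ±) r → RREM Letter
  rrem ε         = ε
  -- An RREM has no constant for the empty language; this test always fails, since `cur` is always
  -- defined.
  rrem ∅         = test (cur ≁ cur)
  rrem (sym a)   = sym (liftLetter a)
  rrem (e₁ · e₂) = rrem e₁ · rrem e₂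
  rrem (e₁ ∪ e₂) = rrem e₁ ∪ rrem e₂
  rrem (e ⁺)     = rrem e ⁺
  rrem (↓ X e)   = storing X · rrem e
  rrem (e ⟦ c ⟧) = rrem e · test (rigid c)

  -- The final detour is possible only from a node of the original graph.
  closed : RREM Letter → RREM Letter
  closed e = e · (sym enter · sym leave)

  module Simulation {D : Set} (𝓖 : DataGraph D Σ) where
    open DataGraph 𝓖
    open Tracking {Σ} {D} k hiding (Letter)
    module 𝓖′ = DataGraph (dataToNode 𝓖 k)

    η′ : Vdn 𝓖 k → D
    η′ = ηdn 𝓖 k

    infix 4 _≈_
    _≈_ : Assignment D k → Assignment D r → Set
    Θ ≈ θ = ∀ x → Θ (inject≤ x r≤k) ≡ θ x

    local-term : ∀ i → LocalTerm (term i)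
    local-term zero    = cur
    local-term (suc x) = lastMark _

    local-rigid : ∀ c → Local (rigid c)
    local-rigid (i ∼ j)  = local-term i , local-term j
    local-rigid (i ≁ j)  = local-term i , local-term j
    local-rigid (c ∨ c′) = local-rigid c , local-rigid c′
    local-rigid (c ∧ c′) = local-rigid c , local-rigid c′

    local-stored : ∀ X → Local (stored X)
    local-stored []      = cur , cur
    local-stored (x ∷ X) = (lastMark _ , cur) , local-stored X

    local-storing : ∀ X → LocalRREM (storing X)
    local-storing []      = tt
    local-storing (x ∷ X) = (tt , tt) , local-storing X

    local-rrem : ∀ e → LocalRREM (rrem e)
    local-rrem ε         = tt
    local-rrem ∅         = cur , cur
    local-rrem (sym a)   = tt
    local-rrem (e₁ · e₂) = local-rrem e₁ , local-rrem e₂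
    local-rrem (e₁ ∪ e₂) = local-rrem e₁ , local-rrem e₂
    local-rrem (e ⁺)     = local-rrem e
    local-rrem (↓ X e)   = local-storing X , local-rrem e
    local-rrem (e ⟦ c ⟧) = local-rrem e , local-rigid c

    module _ {Θ θ} (Θ≈θ : Θ ≈ θ) {d : D} where

      term-value : ∀ i {v} → TermValue Θ d (term i) v → extend θ d i ≡ just v
      term-value zero    refl = refl
      term-value (suc x) eq   = trans (≡-sym (Θ≈θ x)) eq

      term-value⁻¹ : ∀ i {v} → extend θ d i ≡ just v → TermValue Θ d (term i) v
      term-value⁻¹ zero    refl = refl
      term-value⁻¹ (suc x) eq   = trans (Θ≈θ x) eq

      equal⇒same : ∀ i j → Equal Θ d (term i) (term j) → SameValue θ d i j
      equal⇒same i j (v , p , q) with term-value i p | term-value j q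
      ... | eq | eq′ = defined eq , defined eq′ , trans eq (≡-sym eq′)
        where
        defined : ∀ {m} → m ≡ just v → m ≢ nothing
        defined refl ()

      same⇒equal : ∀ i j → SameValue θ d i j → Equal Θ d (term i) (term j)
      same⇒equal i j (def , _ , eq) with extend θ d i in eq′
      ... | nothing = contradiction refl def
      ... | just v  = v , term-value⁻¹ i eq′ , term-value⁻¹ j (≡-sym eq)

      rigid⇒ : ∀ c → Satisfies Θ d (rigid c) → θ , d ⊨ c
      rigid⇐ : ∀ c → θ , d ⊨ c → Satisfies Θ d (rigid c)
      rigid⇒ (i ∼ j)  s        = equal⇒same i j s
      rigid⇒ (i ≁ j)  s        = λ s′ → s (same⇒equal i j s′)
      rigid⇒ (c ∨ c′) (inj₁ s) = inj₁ (rigid⇒ c s)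
      rigid⇒ (c ∨ c′) (inj₂ s) = inj₂ (rigid⇒ c′ s)
      rigid⇒ (c ∧ c′) (s , s′) = rigid⇒ c s , rigid⇒ c′ s′
      rigid⇐ (i ∼ j)  s        = same⇒equal i j s
      rigid⇐ (i ≁ j)  s        = λ s′ → s (equal⇒same i j s′)
      rigid⇐ (c ∨ c′) (inj₁ s) = inj₁ (rigid⇐ c s)
      rigid⇐ (c ∨ c′) (inj₂ s) = inj₂ (rigid⇐ c′ s)
      rigid⇐ (c ∧ c′) (s , s′) = rigid⇐ c s , rigid⇐ c′ s′

    always-satisfied : ∀ Θ d → Satisfies Θ d always
    always-satisfied Θ d = d , refl , refl

    stored⇒ : ∀ {Θ d} X → Satisfies Θ d (stored X) →
              ∀ {x} → x ∈ X → Θ (inject≤ x r≤k) ≡ just d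
    stored⇒ (x ∷ X) ((_ , eq , refl) , _) (here refl) = eq
    stored⇒ (x ∷ X) (_ , s)               (there x∈X) = stored⇒ X s x∈X

    stored⇐ : ∀ {Θ d} X → (∀ {x} → x ∈ X → Θ (inject≤ x r≤k) ≡ just d) →
              Satisfies Θ d (stored X)
    stored⇐ {Θ} []  h = always-satisfied Θ _
    stored⇐ (x ∷ X) h = (_ , h (here refl) , refl) , stored⇐ X (λ x∈X → h (there x∈X))

    track-mark : ∀ Θ {θ} → Θ ≈ θ → ∀ x d → track Θ (mark x) d ≈ θ [ x ∷ [] ≔ d ]
    track-mark Θ {θ} Θ≈θ x d y with y Fin.≟ x
    ... | yes refl = assign-∈ Θ (inject≤ x r≤k ∷ []) (here refl)
    ... | no  y≢x  = trans (assign-∉ Θ (inject≤ x r≤k ∷ []) λ where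
                              (here eq) → y≢x (Fin.inject≤-injective r≤k r≤k y x eq)) (Θ≈θ y)

    -- Serving the registers of a set one at a time agrees with assigning them at once because every
    -- detour writes the same `d`.
    assign-∷ : ∀ (θ : Assignment D r) x X d y →
               ((θ [ x ∷ [] ≔ d ]) [ X ≔ d ]) y ≡ (θ [ x ∷ X ≔ d ]) y
    assign-∷ θ x X d y with y ∈? X | y Fin.≟ x
      where open DecMembership (Fin._≟_ {r}) using (_∈?_)
    ... | yes _ | yes _ = refl
    ... | yes _ | no  _ = refl
    ... | no  _ | yes _ = refl
    ... | no  _ | no  _ = refl

    track-liftLetter : ∀ Θ {θ} → Θ ≈ θ → ∀ a d → track Θ (liftLetter a) d ≈ θ
    track-liftLetter Θ Θ≈θ (pos a) d = Θ≈θ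
    track-liftLetter Θ Θ≈θ (neg a) d = Θ≈θ

    lifted-edge : ∀ a {p q} → 𝓖′.Traverses p (liftLetter a) q →
                  ∃[ u ] ∃[ v ] p ≡ old u × q ≡ old v × Traverses u a v
    lifted-edge (pos a) (old e) = _ , _ , refl , refl , e
    lifted-edge (neg a) (old e) = _ , _ , refl , refl , e

    lift-edge : ∀ a {u v} → Traverses u a v → 𝓖′.Traverses (old u) (liftLetter a) (old v)
    lift-edge (pos a) e = old e
    lift-edge (neg a) e = old e

    mark-edge : ∀ {x p q} → 𝓖′.E p (inj₂ x) q → ∃[ u ] p ≡ old u × q ≡ node u
    mark-edge (node v x) = v , refl , refl

    -- The new node of `u` is joined to `u` alone, so the way back ends where the detour began,
    -- although it need not use the mark of the way out.
    detour-sound : ∀ {x Θ θ β Θ′ ρ} →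
      Passes η′ (sym (mark x) · sym leave) (Θ , β) (Θ′ , ρ) →
      𝓖′.IsSemipath β → Θ ≈ θ →
      ∃[ u ] first β ≡ old u × first ρ ≡ old u × 𝓖′.IsSemipath ρ × last ρ ≡ last β ×
             Θ′ ≈ θ [ x ∷ [] ≔ η u ]
    detour-sound {x} {Θ} (_ , step , step) (t , t′ , p) Θ≈θ with mark-edge t | mark-edge t′
    ... | u , refl , refl | .u , eq , refl =
      u , refl , eq , p , refl , track-mark Θ Θ≈θ x (η u)

    storing-sound : ∀ X {Θ θ β Θ′ ρ u} →
      Passes η′ (storing X) (Θ , β) (Θ′ , ρ) →
      𝓖′.IsSemipath β → first β ≡ old u → Θ ≈ θ →
      first ρ ≡ old u × 𝓖′.IsSemipath ρ × last ρ ≡ last β × Θ′ ≈ θ [ X ≔ η u ]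
    storing-sound []      refl p eq Θ≈θ = eq , p , refl , Θ≈θ
    storing-sound (x ∷ X) {θ = θ} (_ , d , s) p eq Θ≈θ
      with detour-sound d p Θ≈θ
    ... | u , eq₁ , eq₂ , p′ , l , Θ≈θ′ with trans (≡-sym eq) eq₁
    ... | refl with storing-sound X s p′ eq₂ Θ≈θ′
    ... | eq₃ , p″ , l′ , Θ≈θ″ =
      eq₃ , p″ , trans l′ l , λ y → trans (Θ≈θ″ y) (assign-∷ θ x X (η u) y)

    first-old-storing : ∀ X {Θ β Θ′ ρ v} → Passes η′ (storing X) (Θ , β) (Θ′ , ρ) →
                        𝓖′.IsSemipath β → first ρ ≡ old v → ∃[ u ] first β ≡ old u
    first-old-storing []      refl                p       eq = _ , eq
    first-old-storing (x ∷ X) (_ , (_ , step , _) , _) (t , _) eq with mark-edge t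
    ... | u , eq′ , _ = u , eq′

    rest-semipath : ∀ e {Θ β Θ′ ρ} → Passes η′ e (Θ , β) (Θ′ , ρ) →
                    𝓖′.IsSemipath β → 𝓖′.IsSemipath ρ
    rest-semipath⁺ : ∀ e {κ κ′} → TransClosure (Passes η′ e) κ κ′ →
                     𝓖′.IsSemipath (proj₂ κ) → 𝓖′.IsSemipath (proj₂ κ′)
    rest-semipath ε         refl           p       = p
    rest-semipath (sym a)   step           (_ , p) = p
    rest-semipath (test c)  (refl , _)     p       = p
    rest-semipath (e₁ ∪ e₂) (inj₁ m)       p       = rest-semipath e₁ m p
    rest-semipath (e₁ ∪ e₂) (inj₂ m)       p       = rest-semipath e₂ m p
    rest-semipath (e₁ · e₂) (_ , m₁ , m₂)  p       = rest-semipath e₂ m₂ (rest-semipath e₁ m₁ p)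
    rest-semipath (e ⁺)     ms             p       = rest-semipath⁺ e ms p
    rest-semipath⁺ e [ m ]    p = rest-semipath e m p
    rest-semipath⁺ e (m ∷ ms) p = rest-semipath⁺ e ms (rest-semipath e m p)

    OldFirst : Path (Vdn 𝓖 k) Letter → Set
    OldFirst β = ∃[ u ] first β ≡ old u

    -- The argument runs backwards. A letter of `Σ` and the first step of a detour both leave an old
    -- node, and everything else stays in place; so an old end forces an old start. The forward
    -- version would give nothing, since for `ε` a path may start anywhere.
    first-old : ∀ e {Θ β Θ′ ρ} → Passes η′ (rrem e) (Θ , β) (Θ′ , ρ) →
                𝓖′.IsSemipath β → OldFirst ρ → OldFirst β
    first-old⁺ : ∀ e {κ κ′} → TransClosure (Passes η′ (rrem e)) κ κ′ →
                 𝓖′.IsSemipath (proj₂ κ) → OldFirst (proj₂ κ′) → OldFirst (proj₂ κ)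
    first-old ε         refl          p       o = o
    first-old ∅         (refl , _)    p       o = o
    first-old (sym a)   step          (t , _) o with lifted-edge a t
    ... | u , _ , eq , _ = u , eq
    first-old (e₁ · e₂) (_ , m₁ , m₂) p       o =
      first-old e₁ m₁ p (first-old e₂ m₂ (rest-semipath (rrem e₁) m₁ p) o)
    first-old (e₁ ∪ e₂) (inj₁ m)      p       o = first-old e₁ m p o
    first-old (e₁ ∪ e₂) (inj₂ m)      p       o = first-old e₂ m p o
    first-old (e ⁺)     ms            p       o = first-old⁺ e ms p o
    first-old (↓ X e)   (_ , m₁ , m₂) p       o =
      first-old-storing X m₁ p (proj₂ (first-old e m₂ (rest-semipath (storing X) m₁ p) o))
    first-old (e ⟦ c ⟧) (_ , m , refl , _) p  o = first-old e m p o
    first-old⁺ e [ m ]    p o = first-old e m p o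
    first-old⁺ e (m ∷ ms) p o =
      first-old e m p (first-old⁺ e ms (rest-semipath (rrem e) m p) o)

    record Traced (e : REM (Σ ±) r) (θ : Assignment D r) (u : V)
                  (Θ′ : Assignment D k) (v′ : Vdn 𝓖 k) : Set where
      constructor traced
      field
        {π}      : Path V (Σ ±)
        {θ′}     : Assignment D r
        semipath : IsSemipath π
        starts   : first π ≡ u
        ends     : v′ ≡ old (last π)
        derives  : θ ⊢⟨ e , mapPath η π ⟩ θ′
        agrees   : Θ′ ≈ θ′

    -- The derivation rule is a parameter, so that one gluing argument covers both `cat` and `more`.
    trace-cat : ∀ {e₁ e₂ e θ u Θ′ v′ Θ″ v″} →
      (∀ {θ θ″ θ′ : Assignment D r} {α α₁ α₂} → last α₁ ≡ first α₂ → α ≡ α₁ ⋈ α₂ →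
         θ ⊢⟨ e₁ , α₁ ⟩ θ″ → θ″ ⊢⟨ e₂ , α₂ ⟩ θ′ → θ ⊢⟨ e , α ⟩ θ′) →
      (t : Traced e₁ θ u Θ′ v′) → Traced e₂ (Traced.θ′ t) (last (Traced.π t)) Θ″ v″ →
      Traced e θ u Θ″ v″
    trace-cat rule (traced {π} p refl refl d _) (traced {ρ} q s refl d′ a) = record
      { π        = π ⋈ ρ
      ; semipath = semipath-⋈ 𝓖 π (≡-sym s) p q
      ; starts   = first-⋈ π (≡-sym s)
      ; ends     = cong old (≡-sym (last-⋈ π ρ))
      ; derives  = rule (trans (last-map η π) (trans (cong η (≡-sym s)) (≡-sym (first-map η ρ))))
                        (map-⋈ η π ρ) d d′
      ; agrees   = a
      }

    rrem-sound : ∀ e {Θ θ β Θ′ ρ u} → Passes η′ (rrem e) (Θ , β) (Θ′ , ρ) →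
      𝓖′.IsSemipath β → first β ≡ old u → Θ ≈ θ → Traced e θ u Θ′ (first ρ)
    rrem-sound⁺ : ∀ e {κ κ′ θ u} → TransClosure (Passes η′ (rrem e)) κ κ′ →
      𝓖′.IsSemipath (proj₂ κ) → first (proj₂ κ) ≡ old u → proj₁ κ ≈ θ →
      Traced (e ⁺) θ u (proj₁ κ′) (first (proj₂ κ′))
    rrem-sound ε refl p eq Θ≈θ = traced {π = ⟨ _ ⟩} tt refl eq ε Θ≈θ
    rrem-sound ∅ (refl , s) p eq Θ≈θ = contradiction (always-satisfied (λ _ → nothing) _) s
    rrem-sound (sym a) {Θ} (step {x = x}) (t , p) eq Θ≈θ with lifted-edge a t
    ... | u , v , refl , eq′ , t′ with eq
    ... | refl = traced {π = u −⟨ a ⟩→ ⟨ v ⟩} (t′ , tt) refl eq′ sym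
                   (track-liftLetter Θ Θ≈θ a (η u))
    rrem-sound (e₁ · e₂) (_ , m₁ , m₂) p eq Θ≈θ with rrem-sound e₁ m₁ p eq Θ≈θ
    ... | t = trace-cat cat t
                (rrem-sound e₂ m₂ (rest-semipath (rrem e₁) m₁ p) (Traced.ends t) (Traced.agrees t))
    rrem-sound (e₁ ∪ e₂) (inj₁ m) p eq Θ≈θ with rrem-sound e₁ m p eq Θ≈θ
    ... | traced q s e d a = traced q s e (left d) a
    rrem-sound (e₁ ∪ e₂) (inj₂ m) p eq Θ≈θ with rrem-sound e₂ m p eq Θ≈θ
    ... | traced q s e d a = traced q s e (right d) a
    rrem-sound (e ⁺) ms p eq Θ≈θ = rrem-sound⁺ e ms p eq Θ≈θ
    rrem-sound (↓ X e) {θ = θ} (_ , m₁ , m₂) p eq Θ≈θ with storing-sound X m₁ p eq Θ≈θ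
    ... | eq′ , p′ , _ , Θ≈θ′ with rrem-sound e m₂ p′ eq′ Θ≈θ′
    ... | traced {π} q refl e′ d a =
      traced q refl e′
        (store (subst (λ d′ → (θ [ X ≔ d′ ]) ⊢⟨ e , mapPath η π ⟩ _) (≡-sym (first-map η π)) d)) a
    rrem-sound (e ⟦ c ⟧) (_ , m , refl , s) p eq Θ≈θ with rrem-sound e m p eq Θ≈θ
    ... | traced {π} {θ′} q s′ eq′ d a =
      traced q s′ eq′
        (test d (rigid⇒ a c (subst (λ d → Satisfies _ d (rigid c))
                               (trans (cong η′ eq′) (≡-sym (last-map η π))) s))) a
    rrem-sound⁺ e [ m ] p eq Θ≈θ with rrem-sound e m p eq Θ≈θ
    ... | traced q s e′ d a = traced q s e′ (once d) a
    rrem-sound⁺ e (m ∷ ms) p eq Θ≈θ with rrem-sound e m p eq Θ≈θ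
    ... | t = trace-cat more t
                (rrem-sound⁺ e ms (rest-semipath (rrem e) m p) (Traced.ends t) (Traced.agrees t))

    -- The path is built from its end: ρ is the part that follows.
    record Lifted (P : Rel (Config η′) 0ℓ) (θ : Assignment D r) (u : V)
                  (θ′ : Assignment D r) (ρ : Path (Vdn 𝓖 k) Letter) : Set where
      constructor lifted
      field
        {β}      : Path (Vdn 𝓖 k) Letter
        semipath : 𝓖′.IsSemipath β
        starts   : first β ≡ old u
        ends     : last β ≡ last ρ
        passing  : ∀ {Θ} → Θ ≈ θ → ∃[ Θ′ ] P (Θ , β) (Θ′ , ρ) × Θ′ ≈ θ′

    storing-complete : ∀ X θ {u ρ} → 𝓖′.IsSemipath ρ → first ρ ≡ old u →
                       Lifted (Passes η′ (storing X)) θ u (θ [ X ≔ η u ]) ρ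
    storing-complete []      θ p eq = lifted p eq refl λ Θ≈θ → _ , refl , Θ≈θ
    storing-complete (x ∷ X) θ {u} p eq with storing-complete X (θ [ x ∷ [] ≔ η u ]) p eq
    ... | lifted {β} q s e f =
      lifted {β = old u −⟨ mark x ⟩→ node u −⟨ leave ⟩→ β}
        (node u _ , subst (λ v → 𝓖′.E v _ _) (≡-sym s) (node u zero) , q) refl e λ {Θ} Θ≈θ →
        let Θ′ , m , a = f (track-mark Θ Θ≈θ x (η u)) in
        Θ′ , (_ , (_ , step , step) , m) , λ y → trans (a y) (assign-∷ θ x X (η u) y)

    -- For a concatenation the second factor is lifted first, and its path becomes the continuation
    -- of the first. The extended registers at its start are not yet known then, so the result has
    -- to work for every `Θ` agreeing with `θ`.
    rrem-complete : ∀ {e θ α θ′} → θ ⊢⟨ e , α ⟩ θ′ → ∀ π → α ≡ mapPath η π → IsSemipath π →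
      ∀ {ρ} → 𝓖′.IsSemipath ρ → first ρ ≡ old (last π) →
      Lifted (Passes η′ (rrem e)) θ (first π) θ′ ρ
    rrem-complete ε ⟨ _ ⟩ _ _ q eq = lifted q eq refl λ Θ≈θ → _ , refl , Θ≈θ
    rrem-complete (sym {a = a}) (u −⟨ .a ⟩→ ⟨ v ⟩) refl (t , _) {ρ} q eq =
      lifted {β = old u −⟨ liftLetter a ⟩→ ρ}
        (subst (𝓖′.Traverses (old u) (liftLetter a)) (≡-sym eq) (lift-edge a t) , q) refl refl
        λ {Θ} Θ≈θ → _ , step , track-liftLetter Θ Θ≈θ a (η u)
    rrem-complete (cat {α₁ = α₁} eq₁ refl d₁ d₂) π eq p q eq′ with split-map η α₁ π eq eq₁
    ... | π₁ , π₂ , refl , eq₂ , eq₃ , eq₄ with semipath-⋈⁻¹ 𝓖 π₁ eq₄ p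
    ... | p₁ , p₂ with rrem-complete d₂ π₂ eq₃ p₂ q (trans eq′ (cong old (last-⋈ π₁ π₂)))
    ... | lifted q₂ s₂ e₂ f₂ with rrem-complete d₁ π₁ eq₂ p₁ q₂ (trans s₂ (cong old (≡-sym eq₄)))
    ... | lifted q₁ s₁ e₁ f₁ =
      lifted q₁ (trans s₁ (cong old (≡-sym (first-⋈ π₁ eq₄)))) (trans e₁ e₂) λ Θ≈θ →
        let _ , m₁ , a₁ = f₁ Θ≈θ ; _ , m₂ , a₂ = f₂ a₁ in _ , (_ , m₁ , m₂) , a₂
    rrem-complete (left d) π eq p q eq′ with rrem-complete d π eq p q eq′
    ... | lifted q′ s e f = lifted q′ s e λ Θ≈θ → let _ , m , a = f Θ≈θ in _ , inj₁ m , a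
    rrem-complete (right d) π eq p q eq′ with rrem-complete d π eq p q eq′
    ... | lifted q′ s e f = lifted q′ s e λ Θ≈θ → let _ , m , a = f Θ≈θ in _ , inj₂ m , a
    rrem-complete (once d) π eq p q eq′ with rrem-complete d π eq p q eq′
    ... | lifted q′ s e f = lifted q′ s e λ Θ≈θ → let _ , m , a = f Θ≈θ in _ , [ m ] , a
    rrem-complete (more {α₁ = α₁} eq₁ refl d₁ d₂) π eq p q eq′ with split-map η α₁ π eq eq₁
    ... | π₁ , π₂ , refl , eq₂ , eq₃ , eq₄ with semipath-⋈⁻¹ 𝓖 π₁ eq₄ p
    ... | p₁ , p₂ with rrem-complete d₂ π₂ eq₃ p₂ q (trans eq′ (cong old (last-⋈ π₁ π₂)))
    ... | lifted q₂ s₂ e₂ f₂ with rrem-complete d₁ π₁ eq₂ p₁ q₂ (trans s₂ (cong old (≡-sym eq₄)))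
    ... | lifted q₁ s₁ e₁ f₁ =
      lifted q₁ (trans s₁ (cong old (≡-sym (first-⋈ π₁ eq₄)))) (trans e₁ e₂) λ Θ≈θ →
        let _ , m₁ , a₁ = f₁ Θ≈θ ; _ , m₂ , a₂ = f₂ a₁ in _ , m₁ ∷ m₂ , a₂
    rrem-complete (store {θ = θ} {X = X} d) π refl p q eq′ with rrem-complete d π refl p q eq′
    ... | lifted q₂ s₂ e₂ f₂ with storing-complete X θ q₂ s₂
    ... | lifted q₁ s₁ e₁ f₁ = lifted q₁ s₁ (trans e₁ e₂) λ Θ≈θ →
      let Θ′ , m₁ , a₁ = f₁ Θ≈θ
          _ , m₂ , a₂ = f₂ (subst (λ d → Θ′ ≈ θ [ X ≔ d ]) (≡-sym (first-map η π)) a₁)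
      in _ , (_ , m₁ , m₂) , a₂
    rrem-complete (test {c = c} d s) π refl p q eq′ with rrem-complete d π refl p q eq′
    ... | lifted q′ s′ e f = lifted q′ s′ e λ Θ≈θ →
      let _ , m , a = f Θ≈θ in
      _ , (_ , m , refl , rigid⇐ a c (subst (λ d → _ , d ⊨ c)
                            (trans (last-map η π) (cong η′ (≡-sym eq′))) s)) , a

    rem-correct : ∀ e (v v′ : Vdn 𝓖 k) →
      embed 𝓖 k (Evaluation (REM-Accepts e)) (v , v′) →
      𝓖′.Evaluation (RREM-Accepts (closed (rrem e))) (v , v′)
    rem-correct e _ _ (u , v , (π , p , refl , refl , θ , d) , refl , refl)
      -- The construction starts from the closing detour as the part that follows.
      with rrem-complete d π refl p {ρ = old (last π) −⟨ enter ⟩→ node (last π) −⟨ leave ⟩→ ⟨ old (last π) ⟩}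
             (node _ zero , node _ zero , tt) refl
    ... | lifted {β} q s e′ f with f {θ⊥} (λ _ → refl)
    ... | Θ , m , _ =
      β , q , s , e′ ,
      passes⇒accepts η′ β (closed (rrem e)) (local-rrem e , tt , tt) (_ , m , _ , step , step)

    closing-detour : ∀ {Θ ρ Θ′ v} → Passes η′ (sym enter · sym leave) (Θ , ρ) (Θ′ , ⟨ v ⟩) →
                     𝓖′.IsSemipath ρ → ∃[ u ] first ρ ≡ old u × v ≡ old u
    closing-detour (_ , step , step) (t , t′ , _) with mark-edge t | mark-edge t′
    ... | u , refl , refl | .u , eq , refl = u , refl , eq

    rem-correct⁻¹ : ∀ e (v v′ : Vdn 𝓖 k) →
      𝓖′.Evaluation (RREM-Accepts (closed (rrem e))) (v , v′) →
      embed 𝓖 k (Evaluation (REM-Accepts e)) (v , v′)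
    rem-correct⁻¹ e _ _ (β , q , refl , refl , acc)
      with accepts⇒passes η′ β (closed (rrem e)) (local-rrem e , tt , tt) acc
    -- The closing detour makes the end of `rrem e` an old node; `first-old` carries this to the
    -- start, as `rrem-sound` presupposes.
    ... | _ , (Θ , ρ) , m , m′ with closing-detour m′ (rest-semipath (rrem e) m q)
    ... | u , eq , eq′ with first-old e m q (u , eq)
    ... | v , eq″ with rrem-sound e {θ = θ⊥} m q eq″ (λ _ → refl)
    ... | traced {π} {θ} p s f d _ =
      v , u , (π , p , s , old-injective (trans (≡-sym f) eq) , θ , d) , eq″ , eq′
      where
      old-injective : ∀ {u v : V} → _≡_ {A = Vdn 𝓖 k} (old u) (old v) → u ≡ v
      old-injective refl = refl

-- Register automata

module _ {A B : Set} where

  -- A `concatMap` that also passes the place of each entry: a transition owns the new states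
  -- numbered by its place, so equal entries at different places get separate loops.
  blocks : (ts : List A) → (Fin (length ts) → A → List B) → List B
  blocks []       f = []
  blocks (t ∷ ts) f = f zero t ++ blocks ts (f ∘ suc)

  ∈-blocks⁻ : ∀ ts f {b} → b ∈ blocks ts f → ∃[ i ] b ∈ f i (lookup ts i)
  ∈-blocks⁻ (t ∷ ts) f b∈ with ∈-++⁻ (f zero t) b∈
  ... | inj₁ b∈t = zero , b∈t
  ... | inj₂ b∈ts with ∈-blocks⁻ ts (f ∘ suc) b∈ts
  ...   | i , b∈i = suc i , b∈i

  ∈-blocks⁺ : ∀ ts f {b t} i → lookup ts i ≡ t → b ∈ f i t → b ∈ blocks ts f
  ∈-blocks⁺ (t ∷ ts) f zero    refl b∈ = ∈-++⁺ˡ b∈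
  ∈-blocks⁺ (t ∷ ts) f (suc i) eq   b∈ = ∈-++⁺ʳ (f zero t) (∈-blocks⁺ ts (f ∘ suc) i eq b∈)

-- Two states are added for the closing detour (zero) and two for each of the T
-- transitions that read a value.
data State (n T : ℕ) : Set where
  old : Fin n → State n T
  new : Fin (suc T) → Fin 2 → State n T

-- Old states keep their numbers, which the program can therefore copy; `new j b` receives the
-- number `n + 2 j + b`, which a running counter produces.
code : ∀ {n T} → State n T → Fin (n + suc T * 2)
code {n} {T} (old q)   = q ↑ˡ (suc T * 2)
code {n}     (new j b) = n ↑ʳ combine j b

code-old≢new : ∀ {n T} (q : Fin n) j b → code {n} {T} (old q) ≢ code {n} {T} (new j b)
code-old≢new {n} {T} q j b eq =
  <⇒≢ (<-≤-trans (Fin.toℕ<n q) (m≤m+n n _))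
      (trans (≡-sym (Fin.toℕ-↑ˡ q (suc T * 2)))
             (trans (cong toℕ eq) (Fin.toℕ-↑ʳ n (combine {suc T} j b))))

code-injective : ∀ {n T} (s s′ : State n T) → code s ≡ code s′ → s ≡ s′
code-injective         (old q)   (old q′)  eq = cong old (Fin.↑ˡ-injective _ q q′ eq)
code-injective {n} {T} (old q)   (new j b) eq = contradiction eq (code-old≢new {n} {T} q j b)
code-injective {n} {T} (new j b) (old q)   eq = contradiction (≡-sym eq) (code-old≢new {n} {T} q j b)
code-injective {n} {T} (new j b) (new j′ b′) eq
  with Fin.↑ʳ-injective n (combine {suc T} j b) (combine j′ b′) eq
... | eq′ = cong₂ new (Fin.combine-injectiveˡ j b j′ b′ eq′) (Fin.combine-injectiveʳ j b j′ b′ eq′)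

module Automaton {Σ : Set} {r k′ : ℕ} (r≤k : r ≤ suc k′) (𝓐 : NRA (Σ ±) r) where
  open Translation {Σ} r≤k
  open NRA 𝓐

  T : ℕ
  T = length δd

  StateW StateD : Set
  StateW = State nw T
  StateD = State nd T

  codeW : StateW → Fin (nw + suc T * 2)
  codeW = code

  codeD : StateD → Fin (nd + suc T * 2)
  codeD = code

  pattern at₀ = zero
  pattern at₁ = suc zero

  -- At at₀ the loop waits to go to the new node (or to be left), at₁ to come back
  -- from it.  Keeping at₁ apart matters: a path starting at the new node could
  -- otherwise enter the loop with the step back.
  valueBlock : Fin T → Qd × Constraint r × Qw × List (Fin r) →
               List (Fin (nd + suc T * 2) × RigidConstraint Letter × Fin (nw + suc T * 2))
  valueBlock i (q , c , q′ , X) =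
    (codeD (old q)           , rigid c ∧ stored X , codeW (old q′)) ∷
    (codeD (old q)           , rigid c            , codeW (new (suc i) at₀)) ∷
    (codeD (new (suc i) at₀) , always             , codeW (new (suc i) at₀)) ∷
    (codeD (new (suc i) at₀) , always             , codeW (new (suc i) at₁)) ∷
    (codeD (new (suc i) at₀) , stored X           , codeW (old q′)) ∷ []

  letterBlock : Fin T → Qd × Constraint r × Qw × List (Fin r) →
                List (Fin (nw + suc T * 2) × Letter × Fin (nd + suc T * 2))
  letterBlock i (_ , _ , _ , X) =
    map (λ x → codeW (new (suc i) at₀) , mark x , codeD (new (suc i) at₀)) X ++
    (codeW (new (suc i) at₁) , leave , codeD (new (suc i) at₀)) ∷ []

  nrra : NRRA Letter
  nrra = record
    { nw = nw + suc T * 2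
    ; nd = nd + suc T * 2
    ; δw = map (λ q → codeW (old q) , enter , codeD (new zero at₀)) F ++
           (codeW (new zero at₀) , leave , codeD (new zero at₁)) ∷
           map (λ (q , a , q′) → codeW (old q) , liftLetter a , codeD (old q′)) δw ++
           blocks δd letterBlock
    ; δd = (codeD (new zero at₀) , always , codeW (new zero at₀)) ∷
           (codeD (new zero at₁) , always , codeW (new zero at₁)) ∷
           blocks δd valueBlock
    ; I  = map (codeD ∘ old) I
    ; F  = codeW (new zero at₁) ∷ []
    }

  private module 𝓑 = NRRA nrra

  -- The rules by purpose, on states before coding; injectivity of `code` allows case analysis on
  -- them. `direct` bypasses the loop, and soundly so: where `stored X` holds already, assigning the
  -- current value to `X` changes nothing.
  data ValueStep : StateD → RigidConstraint Letter → StateW → Set where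
    direct   : ∀ {i q c q′ X} → lookup δd i ≡ (q , c , q′ , X) →
               ValueStep (old q) (rigid c ∧ stored X) (old q′)
    depart    : ∀ {i q c q′ X} → lookup δd i ≡ (q , c , q′ , X) →
               ValueStep (old q) (rigid c) (new (suc i) at₀)
    continue : ∀ j b → ValueStep (new (suc j) at₀) always (new (suc j) b)
    finish   : ∀ {i q c q′ X} → lookup δd i ≡ (q , c , q′ , X) →
               ValueStep (new (suc i) at₀) (stored X) (old q′)
    close    : ∀ b → ValueStep (new zero b) always (new zero b)

  data LetterStep : StateW → Letter → StateD → Set where
    lifted : ∀ {q a q′} → (q , a , q′) ∈ δw →
             LetterStep (old q) (liftLetter a) (old q′)
    out    : ∀ {i q c q′ X x} → lookup δd i ≡ (q , c , q′ , X) → x ∈ X →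
             LetterStep (new (suc i) at₀) (mark x) (new (suc i) at₀)
    home   : ∀ i → LetterStep (new (suc i) at₁) leave (new (suc i) at₀)
    close₀ : ∀ {q} → q ∈ F → LetterStep (old q) enter (new zero at₀)
    close₁ : LetterStep (new zero at₀) leave (new zero at₁)

  valueStep⇒∈ : ∀ {s c s′} → ValueStep s c s′ → (codeD s , c , codeW s′) ∈ 𝓑.δd
  valueStep⇒∈ (close at₀) = here refl
  valueStep⇒∈ (close at₁) = there (here refl)
  valueStep⇒∈ (direct {i} eq) =
    there (there (∈-blocks⁺ δd valueBlock i eq (here refl)))
  valueStep⇒∈ (depart {i} eq) =
    there (there (∈-blocks⁺ δd valueBlock i eq (there (here refl))))
  valueStep⇒∈ (continue i at₀) =
    there (there (∈-blocks⁺ δd valueBlock i refl (there (there (here refl)))))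
  valueStep⇒∈ (continue i at₁) =
    there (there (∈-blocks⁺ δd valueBlock i refl (there (there (there (here refl))))))
  valueStep⇒∈ (finish {i} eq) =
    there (there (∈-blocks⁺ δd valueBlock i eq (there (there (there (there (here refl)))))))

  ∈⇒valueStep : ∀ {q c q′} → (q , c , q′) ∈ 𝓑.δd →
                ∃[ s ] ∃[ s′ ] q ≡ codeD s × q′ ≡ codeW s′ × ValueStep s c s′
  ∈⇒valueStep (here refl)         = _ , _ , refl , refl , close at₀
  ∈⇒valueStep (there (here refl)) = _ , _ , refl , refl , close at₁
  ∈⇒valueStep (there (there t)) with ∈-blocks⁻ δd valueBlock t
  ... | i , here refl                                 = _ , _ , refl , refl , direct {i} refl
  ... | i , there (here refl)                         = _ , _ , refl , refl , depart refl
  ... | i , there (there (here refl))                 = _ , _ , refl , refl , continue i at₀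
  ... | i , there (there (there (here refl)))         = _ , _ , refl , refl , continue i at₁
  ... | i , there (there (there (there (here refl)))) = _ , _ , refl , refl , finish refl

  valueStep-from : ∀ s {q c q′} → (q , c , q′) ∈ 𝓑.δd → q ≡ codeD s →
                   ∃[ s′ ] q′ ≡ codeW s′ × ValueStep s c s′
  valueStep-from s t eq with ∈⇒valueStep t
  ... | s₁ , s′ , eq₁ , eq₂ , v with code-injective s₁ s (trans (≡-sym eq₁) eq)
  ... | refl = s′ , eq₂ , v

  letterStep⇒∈ : ∀ {s a s′} → LetterStep s a s′ → (codeW s , a , codeD s′) ∈ 𝓑.δw
  letterStep⇒∈ (close₀ q∈F) = ∈-++⁺ˡ (∈-map⁺ _ q∈F)
  letterStep⇒∈ close₁       = ∈-++⁺ʳ (map _ F) (here refl)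
  letterStep⇒∈ (lifted t)   = ∈-++⁺ʳ (map _ F) (there (∈-++⁺ˡ (∈-map⁺ _ t)))
  letterStep⇒∈ (home i)     =
    ∈-++⁺ʳ (map _ F) (there (∈-++⁺ʳ (map _ δw) (∈-blocks⁺ δd letterBlock i refl
      (∈-++⁺ʳ (map _ (proj₂ (proj₂ (proj₂ (lookup δd i))))) (here refl)))))
  letterStep⇒∈ (out {i} eq x∈X) =
    ∈-++⁺ʳ (map _ F) (there (∈-++⁺ʳ (map _ δw) (∈-blocks⁺ δd letterBlock i eq
      (∈-++⁺ˡ (∈-map⁺ _ x∈X)))))

  ∈⇒letterStep : ∀ {q a q′} → (q , a , q′) ∈ 𝓑.δw →
                 ∃[ s ] ∃[ s′ ] q ≡ codeW s × q′ ≡ codeD s′ × LetterStep s a s′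
  ∈⇒letterStep t with ∈-++⁻ (map _ F) t
  ... | inj₁ t′ with ∈-map⁻ _ t′
  ...   | _ , q∈F , refl = _ , _ , refl , refl , close₀ q∈F
  ∈⇒letterStep t | inj₂ (here refl) = _ , _ , refl , refl , close₁
  ∈⇒letterStep t | inj₂ (there t′) with ∈-++⁻ (map _ δw) t′
  ... | inj₁ t″ with ∈-map⁻ _ t″
  ...   | _ , t‴ , refl = _ , _ , refl , refl , lifted t‴
  ∈⇒letterStep t | inj₂ (there t′) | inj₂ t″ with ∈-blocks⁻ δd letterBlock t″
  ... | i , b with ∈-++⁻ (map _ (proj₂ (proj₂ (proj₂ (lookup δd i))))) b
  ...   | inj₂ (here refl) = _ , _ , refl , refl , home i
  ...   | inj₁ b′ with ∈-map⁻ _ b′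
  ...     | _ , x∈X , refl = _ , _ , refl , refl , out refl x∈X

  letterStep-from : ∀ s {q a q′} → (q , a , q′) ∈ 𝓑.δw → q ≡ codeW s →
                    ∃[ s′ ] q′ ≡ codeD s′ × LetterStep s a s′
  letterStep-from s t eq with ∈⇒letterStep t
  ... | s₁ , s′ , eq₁ , eq₂ , l with code-injective s₁ s (trans (≡-sym eq₁) eq)
  ... | refl = s′ , eq₂ , l

  module Runs {D : Set} (𝓖 : DataGraph D Σ) where
    open DataGraph 𝓖
    open Simulation 𝓖
    open Tracking {Σ} {D} k hiding (Letter)

    local-δd : ∀ {q c q′} → (q , c , q′) ∈ 𝓑.δd → Local c
    local-δd t with ∈⇒valueStep t
    ... | _ , _ , _ , _ , direct {c = c} {X = X} _ = local-rigid c , local-stored X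
    ... | _ , _ , _ , _ , depart {c = c} _          = local-rigid c
    ... | _ , _ , _ , _ , continue _ _             = cur , cur
    ... | _ , _ , _ , _ , finish {X = X} _         = local-stored X
    ... | _ , _ , _ , _ , close _                  = cur , cur

    ReadsV : StateD → Config η′ → Set
    ReadsV s = ReadsValue η′ nrra (codeD s)

    ReadsL : StateW → Config η′ → Set
    ReadsL s = ReadsLetter η′ nrra (codeW s)

    -- The point inside a step of `𝓐` after the first value of the path is read and before the next
    -- letter. The loop of detours takes place exactly here.
    data AcceptsAfter (q : Qw) (θ : Assignment D r) : Path D (Σ ±) → Set where
      stop : ∀ {d} → q ∈ F → AcceptsAfter q θ ⟨ d ⟩
      step : ∀ {d a q′ α} → (q , a , q′) ∈ δw → AcceptsFrom 𝓐 q′ θ α →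
             AcceptsAfter q θ (d −⟨ a ⟩→ α)

    read : ∀ {q c q′ X θ α} → (q , c , q′ , X) ∈ δd → θ , first α ⊨ c →
           AcceptsAfter q′ (θ [ X ≔ first α ]) α → AcceptsFrom 𝓐 q θ α
    read t s (stop f)    = stop t s f
    read t s (step t′ a) = step t s t′ a

    record Projected (P : Path D (Σ ±) → Set) (u : V) (v′ : Vdn 𝓖 k) : Set where
      constructor projected
      field
        {π}      : Path V (Σ ±)
        semipath : IsSemipath π
        starts   : first π ≡ u
        ends     : v′ ≡ old (last π)
        holds    : P (mapPath η π)

    -- The two nodes that carry the value of `u`. Soundness has to allow both, because the loop
    -- visits the new node and the path might start there.
    At : Vdn 𝓖 k → V → Set
    At p u = p ≡ old u ⊎ p ≡ node u

    at-value : ∀ {p u} → At p u → η′ p ≡ η u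
    at-value (inj₁ refl) = refl
    at-value (inj₂ refl) = refl

    -- The invariant of the loop: detours write registers of `X` only. The test `stored X` on
    -- leaving settles the registers inside `X`, however often they were served.
    AgreesOff : List (Fin r) → Assignment D k → Assignment D r → Set
    AgreesOff X Θ θ = ∀ x → x ∉ X → Θ (inject≤ x r≤k) ≡ θ x

    agrees-stored : ∀ X {Θ θ d} → AgreesOff X Θ θ → Satisfies Θ d (stored X) → Θ ≈ θ [ X ≔ d ]
    agrees-stored X {Θ} {θ} {d} off s x with x ∈? X
      where open DecMembership (Fin._≟_ {r}) using (_∈?_)
    ... | yes x∈X = stored⇒ X s x∈X
    ... | no  x∉X = off x x∉X

    track-off : ∀ {X Θ θ x d} → x ∈ X → AgreesOff X Θ θ → AgreesOff X (track Θ (mark x) d) θ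
    track-off {Θ = Θ} {x = x} x∈X off y y∉X =
      trans (assign-∉ Θ (inject≤ x r≤k ∷ []) λ where
               (here eq) → y∉X (subst (_∈ _) (≡-sym (Fin.inject≤-injective r≤k r≤k y x eq)) x∈X))
            (off y y∉X)

    final⇒ : ∀ s → codeW s ∈ 𝓑.F → s ≡ new zero at₁
    final⇒ s (here eq) = code-injective s _ eq

    ∈-δd : ∀ {i t} → lookup δd i ≡ t → t ∈ δd
    ∈-δd {i} refl = ∈-lookup i

    sound-close₁ : ∀ {q Θ β} → ReadsValue η′ nrra q (Θ , β) → q ≡ codeD (new zero at₁) →
                   first β ≡ last β
    sound-close₁ (readValue t _ (stop _)) eq = refl
    sound-close₁ (readValue t _ (readLetter t′ _)) eq with valueStep-from (new zero at₁) t eq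
    ... | _ , eq′ , close _ with letterStep-from (new zero at₁) t′ eq′
    ... | ()

    -- From these states only the step back and then stopping are possible, so the path ends at the
    -- old node where the closing detour began.
    sound-close₀ : ∀ {q Θ β u} → ReadsValue η′ nrra q (Θ , β) → q ≡ codeD (new zero at₀) →
                   𝓖′.IsSemipath β → first β ≡ node u → last β ≡ old u
    sound-close₀ (readValue t _ r) eq p eq′ with valueStep-from (new zero at₀) t eq
    sound-close₀ (readValue t _ (stop f)) eq p eq′ | _ , refl , close _ with final⇒ (new zero at₀) f
    ... | ()
    sound-close₀ (readValue t _ (readLetter t′ r)) eq (e , p) eq′ | _ , eq₂ , close _
      with letterStep-from (new zero at₀) t′ eq₂
    ... | _ , eq₄ , close₁ with mark-edge e | sound-close₁ r eq₄
    ... | u , eq₅ , refl | eq₆ with eq′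
    ... | refl = trans (≡-sym eq₆) eq₅

    -- Mutual induction on the run. That the path stands at an old node is a conclusion and not a
    -- hypothesis: every way on from an old state, be it a lifted letter, a mark or the closing
    -- detour, leaves an old node. Applied to the initial state, this excludes paths that start at a
    -- new node.
    sound-old-value : ∀ {q q₀ Θ θ β u} → ReadsValue η′ nrra q (Θ , β) → q ≡ codeD (old q₀) →
      𝓖′.IsSemipath β → Θ ≈ θ → At (first β) u →
      first β ≡ old u × Projected (AcceptsFrom 𝓐 q₀ θ) u (last β)
    sound-old-letter : ∀ {q q₀ Θ θ β u} → ReadsLetter η′ nrra q (Θ , β) → q ≡ codeW (old q₀) →
      𝓖′.IsSemipath β → Θ ≈ θ → At (first β) u →
      first β ≡ old u × Projected (AcceptsAfter q₀ θ) u (last β)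
    sound-loop-value : ∀ {i t q q₀ c X Θ θ β u} → ReadsValue η′ nrra t (Θ , β) →
      t ≡ codeD (new (suc i) at₀) → lookup δd i ≡ (q , c , q₀ , X) →
      𝓖′.IsSemipath β → AgreesOff X Θ θ → At (first β) u →
      Projected (AcceptsAfter q₀ (θ [ X ≔ η u ])) u (last β)
    -- Only at `at₀` is the next edge an outgoing mark; at `at₁` the path stands at the new node,
    -- hence the condition on `b`.
    sound-loop-letter : ∀ {i b t q q₀ c X Θ θ β u} → ReadsLetter η′ nrra t (Θ , β) →
      t ≡ codeW (new (suc i) b) → lookup δd i ≡ (q , c , q₀ , X) →
      𝓖′.IsSemipath β → AgreesOff X Θ θ → At (first β) u →
      (b ≡ at₀ → first β ≡ old u) × Projected (AcceptsAfter q₀ (θ [ X ≔ η u ])) u (last β)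

    sound-old-value {q₀ = q₀} {θ = θ} (readValue t s r) eq p Θ≈θ at with valueStep-from (old q₀) t eq
    sound-old-value {θ = θ} (readValue t (s , s′) r) eq p Θ≈θ at | _ , eq₂ , direct {c = c} {X = X} eq₃
      with sound-old-letter r eq₂ p
             (agrees-stored X (λ x _ → Θ≈θ x) (subst (λ d → Satisfies _ d (stored X)) (at-value at) s′)) at
    ... | eq₄ , projected {π} q refl e h =
      eq₄ , projected q refl e (read (∈-δd eq₃)
        (subst (λ d → θ , d ⊨ c) (trans (at-value at) (≡-sym (first-map η π))) (rigid⇒ Θ≈θ c s))
        (subst (λ d → AcceptsAfter _ (θ [ X ≔ d ]) (mapPath η π)) (≡-sym (first-map η π)) h))
    sound-old-value {θ = θ} (readValue t s r) eq p Θ≈θ at | _ , eq₂ , depart {c = c} {X = X} eq₃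
      with sound-loop-letter r eq₂ eq₃ p (λ x _ → Θ≈θ x) at
    ... | eq₄ , projected {π} q refl e h =
      eq₄ refl , projected q refl e (read (∈-δd eq₃)
        (subst (λ d → θ , d ⊨ c) (trans (at-value at) (≡-sym (first-map η π))) (rigid⇒ Θ≈θ c s))
        (subst (λ d → AcceptsAfter _ (θ [ X ≔ d ]) (mapPath η π)) (≡-sym (first-map η π)) h))

    sound-old-letter {q₀ = q₀} (stop f) refl p Θ≈θ at with final⇒ (old q₀) f
    ... | ()
    sound-old-letter {q₀ = q₀} {Θ = Θ} (readLetter t r) eq (e , p) Θ≈θ at with letterStep-from (old q₀) t eq
    ... | _ , eq₂ , lifted {a = a} t′ with lifted-edge a e
    ... | u , v , refl , eq₃ , e′ with sound-old-value r eq₂ p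
            (track-liftLetter Θ Θ≈θ a (η u)) (inj₁ eq₃) | at
    ... | _ , projected {π} q refl en h | inj₁ refl =
      refl , projected {π = u −⟨ a ⟩→ π} (e′ , q) refl en (step t′ h)
    sound-old-letter (readLetter t r) eq (e , p) Θ≈θ at | _ , eq₂ , close₀ q∈F with mark-edge e
    ... | u , refl , eq₃ with sound-close₀ r eq₂ p eq₃ | at
    ... | eq₄ | inj₁ refl = refl , projected {π = ⟨ u ⟩} tt refl eq₄ (stop q∈F)

    sound-loop-value {i} (readValue t s r) eq eq′ p off at with valueStep-from (new (suc i) at₀) t eq
    ... | _ , eq₂ , continue _ _ = proj₂ (sound-loop-letter r eq₂ eq′ p off at)
    ... | _ , eq₂ , finish {X = X} eq₃ with trans (≡-sym eq₃) eq′
    ... | refl = proj₂ (sound-old-letter r eq₂ p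
                   (agrees-stored X off (subst (λ d → Satisfies _ d (stored X)) (at-value at) s)) at)

    sound-loop-letter {i} {b} (stop f) refl eq′ p off at with final⇒ (new (suc i) b) f
    ... | ()
    sound-loop-letter {i} {b} {Θ = Θ} (readLetter t r) eq eq′ (e , p) off at
      with letterStep-from (new (suc i) b) t eq
    sound-loop-letter {Θ = Θ} (readLetter t r) eq eq′ (e , p) off at | _ , eq₂ , out eq₃ x∈X
      -- Both equations look up transition `i`, so `x` belongs to the same `X` as in the invariant.
      with trans (≡-sym eq₃) eq′ | mark-edge e | at
    ... | refl | u , refl , eq₄ | inj₁ refl =
      (λ _ → refl) , sound-loop-value r eq₂ eq′ p (track-off {Θ = Θ} x∈X off) (inj₂ eq₄)
    sound-loop-letter (readLetter t r) eq eq′ (e , p) off at | _ , eq₂ , home _ with mark-edge e | at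
    ... | u , eq₄ , refl | inj₂ refl =
      (λ ()) , sound-loop-value r eq₂ eq′ p off (inj₁ eq₄)

    module _ {i q c q′ X} (eq : lookup δd i ≡ (q , c , q′ , X))
             {θ : Assignment D r} {u : V} {ρ : Path (Vdn 𝓖 k) Letter}
             (semi : 𝓖′.IsSemipath ρ) (starts : first ρ ≡ old u)
             (run : ∀ {Θ} → Θ ≈ θ [ X ≔ η u ] → ReadsL (old q′) (Θ , ρ)) where

      -- Completeness chooses one run of the loop: one detour per entry, in the order of the list.
      detours : List (Fin r) → Path (Vdn 𝓖 k) Letter
      detours []      = ρ
      detours (x ∷ Y) = old u −⟨ mark x ⟩→ node u −⟨ leave ⟩→ detours Y

      first-detours : ∀ Y → first (detours Y) ≡ old u
      first-detours []      = starts
      first-detours (x ∷ Y) = refl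

      last-detours : ∀ Y → last (detours Y) ≡ last ρ
      last-detours []      = refl
      last-detours (x ∷ Y) = last-detours Y

      detours-semipath : ∀ Y → 𝓖′.IsSemipath (detours Y)
      detours-semipath []      = semi
      detours-semipath (x ∷ Y) =
        node u _ , subst (λ v → 𝓖′.E v _ _) (≡-sym (first-detours Y)) (node u zero) ,
        detours-semipath Y

      -- The invariant of that run: a register either awaits its detour or has reached its final
      -- content.
      Pending : List (Fin r) → Assignment D k → Set
      Pending Y Θ = ∀ x → x ∈ Y ⊎ Θ (inject≤ x r≤k) ≡ (θ [ X ≔ η u ]) x

      pending-track : ∀ {x Y Θ} → x ∈ X → Pending (x ∷ Y) Θ → Pending Y (track Θ (mark x) (η u))
      pending-track {x} {Y} {Θ} x∈X pend y with y Fin.≟ x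
      ... | yes refl = inj₂ (trans (assign-∈ Θ (inject≤ x r≤k ∷ []) (here refl))
                                   (≡-sym (assign-∈ θ X x∈X)))
      ... | no  y≢x with pend y
      ...   | inj₁ (here y≡x)  = contradiction y≡x y≢x
      ...   | inj₁ (there y∈Y) = inj₁ y∈Y
      ...   | inj₂ eq′         =
        inj₂ (trans (assign-∉ Θ (inject≤ x r≤k ∷ []) λ where
                       (here eq″) → y≢x (Fin.inject≤-injective r≤k r≤k y x eq″)) eq′)

      loop-value  : ∀ Y {Θ} → (∀ {x} → x ∈ Y → x ∈ X) → Pending Y Θ →
                    ReadsV (new (suc i) at₀) (Θ , detours Y)
      loop-letter : ∀ x Y {Θ} → (∀ {y} → y ∈ x ∷ Y → y ∈ X) → Pending (x ∷ Y) Θ →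
                    ReadsL (new (suc i) at₀) (Θ , detours (x ∷ Y))
      loop-value [] {Θ} sub pend =
        readValue (valueStep⇒∈ (finish eq))
          (stored⇐ X λ {x} x∈X → trans (agrees x)
            (trans (assign-∈ θ X x∈X) (cong (λ v → just (η′ v)) (≡-sym starts))))
          (run agrees)
        where
        agrees : Θ ≈ θ [ X ≔ η u ]
        agrees x with pend x
        ... | inj₂ eq′ = eq′
      loop-value (x ∷ Y) {Θ} sub pend =
        readValue (valueStep⇒∈ (continue i at₀)) (always-satisfied Θ _) (loop-letter x Y sub pend)
      loop-letter x Y {Θ} sub pend =
        readLetter (letterStep⇒∈ (out eq (sub (here refl))))
          (readValue (valueStep⇒∈ (continue i at₁)) (always-satisfied (track Θ (mark x) (η u)) _)
            (readLetter (letterStep⇒∈ (home i))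
              (loop-value Y (λ y∈Y → sub (there y∈Y)) (pending-track {x} {Y} {Θ} (sub (here refl)) pend))))

    record Extended (q : Qd) (θ : Assignment D r) (u : V) (v′ : Vdn 𝓖 k) : Set where
      constructor extended
      field
        {β}      : Path (Vdn 𝓖 k) Letter
        semipath : 𝓖′.IsSemipath β
        starts   : first β ≡ old u
        ends     : last β ≡ v′
        runs     : ∀ {Θ} → Θ ≈ θ → ReadsV (old q) (Θ , β)

    extend-value : ∀ {q c q′ X θ u ρ} → (q , c , q′ , X) ∈ δd → θ , η u ⊨ c →
      𝓖′.IsSemipath ρ → first ρ ≡ old u →
      (∀ {Θ} → Θ ≈ θ [ X ≔ η u ] → ReadsL (old q′) (Θ , ρ)) →
      Extended q θ u (last ρ)
    -- For empty `X` the loop state entered by `depart` has no outgoing letter, so the direct rule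
    -- is taken.
    extend-value {c = c} {X = []} {θ} t s p eq run =
      extended p eq refl λ {Θ} Θ≈θ →
        readValue (valueStep⇒∈ (direct {i = index t} (≡-sym (lookup-index t))))
          (rigid⇐ Θ≈θ c (subst (λ v → θ , η′ v ⊨ c) (≡-sym eq) s) , always-satisfied Θ _)
          (run Θ≈θ)
    extend-value {c = c} {X = x ∷ X} {θ} {u} t s p eq run =
      extended (detours-semipath eq′ p eq run (x ∷ X)) refl (last-detours eq′ p eq run X) λ {Θ} Θ≈θ →
        readValue (valueStep⇒∈ (depart eq′)) (rigid⇐ Θ≈θ c s)
          (loop-letter eq′ p eq run x X (λ y∈ → y∈) (pending {Θ} Θ≈θ))
      where
      eq′ = ≡-sym (lookup-index t)
      pending : ∀ {Θ} → Θ ≈ θ → Pending eq′ p eq run (x ∷ X) Θ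
      pending Θ≈θ y with y ∈? (x ∷ X)
        where open DecMembership (Fin._≟_ {r}) using (_∈?_)
      ... | yes y∈ = inj₁ y∈
      ... | no  y∉ = inj₂ (trans (Θ≈θ y) (≡-sym (assign-∉ θ (x ∷ X) y∉)))

    complete : ∀ {q θ α} → AcceptsFrom 𝓐 q θ α → ∀ π → α ≡ mapPath η π → IsSemipath π →
               Extended q θ (first π) (old (last π))
    complete (stop t s f) ⟨ u ⟩ refl p =
      extend-value {ρ = old u −⟨ enter ⟩→ node u −⟨ leave ⟩→ ⟨ old u ⟩} t s
        (node u zero , node u zero , tt) refl λ {Θ} _ →
        readLetter (letterStep⇒∈ (close₀ f))
          (readValue (valueStep⇒∈ (close at₀)) (always-satisfied (track Θ enter (η u)) _)
            (readLetter (letterStep⇒∈ close₁)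
              (readValue (valueStep⇒∈ (close at₁)) (always-satisfied (track Θ enter (η u)) _)
                (stop (here refl)))))
    complete {θ = θ} (step {X = X} {a = a} t s t′ r) (u −⟨ .a ⟩→ π) refl (e , p) with complete r π refl p
    ... | extended {β} q st en run =
      subst (Extended _ θ u) en (extend-value {ρ = old u −⟨ liftLetter a ⟩→ β} t s
        (subst (𝓖′.Traverses (old u) (liftLetter a)) (≡-sym st) (lift-edge a e) , q) refl λ {Θ} Θ≈θ →
        readLetter (letterStep⇒∈ (lifted t′))
          (run (track-liftLetter Θ Θ≈θ a (η u))))

    nra-correct : ∀ (v v′ : Vdn 𝓖 k) →
      embed 𝓖 k (Evaluation (NRA-Accepts 𝓐)) (v , v′) →
      𝓖′.Evaluation (NRRA-Accepts nrra) (v , v′)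
    nra-correct _ _ (u , v , (π , p , refl , refl , q , q∈I , acc) , refl , refl)
      with complete acc π refl p
    ... | extended {β} s st en run =
      β , s , st , en , codeD (old q) , ∈-map⁺ _ q∈I ,
      reads⁻¹ η′ nrra local-δd β refl (run {θ⊥} λ _ → refl)

    nra-correct⁻¹ : ∀ (v v′ : Vdn 𝓖 k) →
      𝓖′.Evaluation (NRRA-Accepts nrra) (v , v′) →
      embed 𝓖 k (Evaluation (NRA-Accepts 𝓐)) (v , v′)
    nra-correct⁻¹ v _ (β , p , eq , refl , q , q∈I , acc) with ∈-map⁻ _ q∈I | someAt v
      where
      someAt : ∀ v → ∃[ u ] At v u
      someAt (old u)  = u , inj₁ refl
      someAt (node u) = u , inj₂ refl
    ... | q₀ , q₀∈I , refl | u , at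
      with sound-old-value (reads η′ nrra local-δd β acc) refl p (λ _ → refl {x = nothing})
             (subst (λ v → At v u) (≡-sym eq) at)
    ... | eq′ , projected {π} s st en h =
      u , last π , (π , s , st , refl , q₀ , q₀∈I , h) , trans (≡-sym eq) eq′ , en

-- The translation of queries and its correctness.

module _ {Σ : Set} {r k′ : ℕ} (r≤k : r ≤ suc k′) where
  open Translation {Σ} r≤k using (closed; rrem; module Simulation)

  translate : 2RDPQ Σ r → 2RRDPQ (Σ+A Σ (suc k′))
  translate ξ = record
    { x = 2RDPQ.x ξ
    ; L = Sum.map (Automaton.nrra r≤k) (closed ∘ rrem) (2RDPQ.L ξ)
    ; y = 2RDPQ.y ξ
    }

  translate-correct : ∀ ξ {D : Set} (𝓖 : DataGraph D Σ) →
    embed 𝓖 (suc k′) (2RDPQ.evaluate ξ 𝓖) ≐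
    2RRDPQ.evaluate (translate ξ) (dataToNode 𝓖 (suc k′))
  translate-correct record { L = inj₁ 𝓐 } 𝓖 =
    (λ {(v , v′)} → nra-correct v v′) , (λ {(v , v′)} → nra-correct⁻¹ v v′)
    where open Automaton.Runs r≤k 𝓐 𝓖
  translate-correct record { L = inj₂ e } 𝓖 =
    (λ {(v , v′)} → rem-correct e v v′) , (λ {(v , v′)} → rem-correct⁻¹ e v v′)
    where open Simulation 𝓖

-- Cost of programs

-- Reduces an inequality to an equation with explicit slack, which the ring solver decides.
≤-slack : ∀ {m n} k → m + k ≡ n → m ≤ n
≤-slack {m} k refl = m≤m+n m k

-- The number of nodes to be paid for. Repetition comes from calls alone, so one activation of a
-- body evaluates each node at most once.
weight : ∀ {f n} → Exp f n → ℕ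
weight (var _)       = 1
weight nil           = 1
weight (e ∙ e′)      = 1 + (weight e + weight e′)
weight (case e e₁ e₂) = 1 + (weight e + (weight e₁ + weight e₂))
weight (bind e e′)   = 1 + (weight e + weight e′)
weight (call _ e)    = 1 + weight e

totalWeight : ∀ {f n} → Vec (Exp f 1) n → ℕ
totalWeight []       = 0
totalWeight (e ∷ es) = weight e + totalWeight es

weight≤total : ∀ {f n} (es : Vec (Exp f 1) n) i → weight (Vec.lookup es i) ≤ totalWeight es
weight≤total (e ∷ es) zero    = m≤m+n _ _
weight≤total (e ∷ es) (suc i) = ≤-trans (weight≤total es i) (m≤n+m _ (weight e))

size-positive : ∀ t → 1 ≤ size t
size-positive nil     = s≤s z≤n
size-positive (_ ∙ _) = s≤s z≤n

size-left : ∀ {M} s t → size (s ∙ t) ≤ M → size s ≤ M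
size-left s t h = ≤-trans (≤-trans (m≤m+n _ (size t)) (n≤1+n _)) h

size-tail : ∀ s t u → size (t ∙ u) ≤ size ((s ∙ t) ∙ u)
size-tail s t u = s≤s (+-monoˡ-≤ (size u) (≤-trans (m≤n+m (size t) (size s)) (n≤1+n _)))

size-right : ∀ {M} s t → size (s ∙ t) ≤ M → size t ≤ M
size-right s t h = ≤-trans (≤-trans (m≤n+m _ (size s)) (n≤1+n _)) h

module _ (P : Program) (M : ℕ) where
  open Program P

  -- Runs ρ e t a b: with a calls available, e evaluates to t and leaves b of
  -- them, and no argument of a call has size above M.
  data Runs {n : ℕ} (ρ : Vec Tree n) : Exp funs n → Tree → ℕ → ℕ → Set where
    var     : ∀ i {a} → Runs ρ (var i) (Vec.lookup ρ i) a a
    nil     : ∀ {a} → Runs ρ nil nil a a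
    _∙_     : ∀ {e e′ s t a b c} → Runs ρ e s a b → Runs ρ e′ t b c →
              Runs ρ (e ∙ e′) (s ∙ t) a c
    case₁   : ∀ {i e₁ e₂ t a b} → Vec.lookup ρ i ≡ nil → Runs ρ e₁ t a b →
              Runs ρ (case (var i) e₁ e₂) t a b
    case₂   : ∀ {i e₁ e₂ l r t a b} → Vec.lookup ρ i ≡ l ∙ r → Runs (l ∷ r ∷ ρ) e₂ t a b →
              Runs ρ (case (var i) e₁ e₂) t a b
    call    : ∀ {g e s t a b c} → Runs ρ e s a (suc b) → size s ≤ M →
              Runs (s ∷ []) (Vec.lookup body g) t b c → Runs ρ (call g e) t a c
    callVar : ∀ {g i t b c} → Runs (Vec.lookup ρ i ∷ []) (Vec.lookup body g) t b c →
              Runs ρ (call g (var i)) t (suc b) c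

  -- Covers one activation of any function, since the total weight bounds the weight of every single
  -- body.
  perCall : ℕ
  perCall = totalWeight body * suc M

  private
    Small : ∀ {n} → Vec Tree n → Set
    Small ρ = ∀ i → size (Vec.lookup ρ i) ≤ M

    small-∷ : ∀ {n t} {ρ : Vec Tree n} → size t ≤ M → Small ρ → Small (t ∷ ρ)
    small-∷ h hs zero    = h
    small-∷ h hs (suc i) = hs i

    small-[] : Small []
    small-[] ()

    -- In the sum of the hypotheses the credit `x`, handed from the first subrun to the second,
    -- stands on both sides and cancels. The slack `u` is the difference between the unit charged
    -- for a node and its allotment.
    combine-costs : ∀ {m₁ m₂ w₁ w₂ x y z} u → m₁ + x ≤ w₁ + y → m₂ + z ≤ w₂ + x →
                    suc (m₁ + m₂) + z ≤ (suc u + (w₁ + w₂)) + y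
    combine-costs {m₁} {m₂} {w₁} {w₂} {x} {y} {z} u p q = +-cancelʳ-≤ x _ _ (begin
      suc (m₁ + m₂) + z + x         ≡⟨ e₁ m₁ m₂ x z ⟩
      1 + ((m₁ + x) + (m₂ + z))     ≤⟨ +-mono-≤ (s≤s (z≤n {u})) (+-mono-≤ p q) ⟩
      suc u + ((w₁ + y) + (w₂ + x)) ≡⟨ e₂ u w₁ w₂ x y ⟩
      suc u + (w₁ + w₂) + y + x     ∎)
      where
      open ≤-Reasoning
      e₁ : ∀ m₁ m₂ x z → suc (m₁ + m₂) + z + x ≡ 1 + ((m₁ + x) + (m₂ + z))
      e₁ = solve-∀
      e₂ : ∀ u w₁ w₂ x y → suc u + ((w₁ + y) + (w₂ + x)) ≡ suc u + (w₁ + w₂) + y + x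
      e₂ = solve-∀

    cost-pair : ∀ w₁ w₂ m₁ m₂ x y z →
                m₁ + x ≤ w₁ * suc M + y → m₂ + z ≤ w₂ * suc M + x →
                suc (m₁ + m₂) + z ≤ suc (w₁ + w₂) * suc M + y
    cost-pair w₁ w₂ m₁ m₂ x y z p q =
      ≤-trans (combine-costs {m₁} {m₂} {w₁ * suc M} {w₂ * suc M} M p q)
        (≤-reflexive (cong (λ w → suc M + w + y) (≡-sym (*-distribʳ-+ (suc M) w₁ w₂))))

    cost-call : ∀ w₁ m₁ m₂ x y z →
                m₁ + x ≤ w₁ * suc M + y → m₂ + z ≤ x →
                suc (m₁ + m₂) + z ≤ suc w₁ * suc M + y
    cost-call w₁ m₁ m₂ x y z p q =
      subst (λ w → suc (m₁ + m₂) + z ≤ suc w * suc M + y) (+-identityʳ w₁)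
        (cost-pair w₁ 0 m₁ m₂ x y z p q)

    cost-var : ∀ {t} x → size t ≤ M → suc (size t) + x ≤ 1 * suc M + x
    cost-var x h = +-monoˡ-≤ x (≤-trans (s≤s h) (m≤m+n (suc M) 0))

  -- Amortised analysis: a call spends one credit worth `perCall`, which pays for the nodes of the
  -- called body, while calls made there spend credits of their own. As `Runs` inspects variables
  -- only, bound subtrees are no larger than trees already in the environment; just the arguments
  -- built anew need a size bound.
  cost : ∀ {n} {ρ : Vec Tree n} {e t a b} → Runs ρ e t a b → Small ρ →
         ∃[ m ] _⊢_⇓_∣_ P ρ e t m × m + b * perCall ≤ weight e * suc M + a * perCall
  cost (var i {a}) h = _ , var i , cost-var (a * perCall) (h i)
  cost (nil {a}) h = _ , nil , +-monoˡ-≤ (a * perCall) (s≤s z≤n)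
  cost (_∙_ {e} {e′} {a = a} {b} {c} r r′) h with cost r h | cost r′ h
  ... | m , d , p | m′ , d′ , p′ =
    _ , (d ∙ d′) ,
    cost-pair (weight e) (weight e′) m m′ (b * perCall) (a * perCall) (c * perCall) p p′
  cost {ρ = ρ} (case₁ {i} {e₁} {e₂} {a = a} {b} eq r) h with cost r h
  ... | m , d , p =
    _ , case₁ (subst (λ t → _⊢_⇓_∣_ P ρ (var i) t (suc (size (Vec.lookup ρ i)))) eq (var i)) d ,
    cost-pair 1 (weight e₁ + weight e₂) _ m (a * perCall) (a * perCall) (b * perCall)
      (cost-var (a * perCall) (h i))
      (≤-trans p (+-monoˡ-≤ (a * perCall) (*-monoˡ-≤ (suc M) (m≤m+n (weight e₁) (weight e₂)))))
  cost {ρ = ρ} (case₂ {i} {e₁} {e₂} {l} {r} {a = a} {b} eq run) h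
    with cost run (small-∷ (size-left l r small) (small-∷ (size-right l r small) h))
    where
    small : size (l ∙ r) ≤ M
    small = subst (λ t → size t ≤ M) eq (h i)
  ... | m , d , p =
    _ , case₂ (subst (λ t → _⊢_⇓_∣_ P ρ (var i) t (suc (size (Vec.lookup ρ i)))) eq (var i)) d ,
    cost-pair 1 (weight e₁ + weight e₂) _ m (a * perCall) (a * perCall) (b * perCall)
      (cost-var (a * perCall) (h i))
      (≤-trans p (+-monoˡ-≤ (a * perCall) (*-monoˡ-≤ (suc M) (m≤n+m (weight e₂) (weight e₁)))))
  cost (call {g} {e} {a = a} {b} {c} r h′ r′) h with cost r h | cost r′ (small-∷ h′ small-[])
  ... | m , d , p | m′ , d′ , p′ =
    _ , call d d′ ,
    cost-call (weight e) m m′ (suc b * perCall) (a * perCall) (c * perCall) p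
      (≤-trans p′ (+-monoˡ-≤ (b * perCall) (*-monoˡ-≤ (suc M) (weight≤total body g))))
  cost (callVar {g} {i} {b = b} {c} r) h with cost r (small-∷ (h i) small-[])
  ... | m , d , p =
    _ , call (var i) d ,
    cost-call 1 _ m (suc b * perCall) (suc b * perCall) (c * perCall)
      (cost-var (suc b * perCall) (h i))
      (≤-trans p (+-monoˡ-≤ (b * perCall) (*-monoˡ-≤ (suc M) (weight≤total body g))))

-- The translating program

module _ {f n : ℕ} where

  numeral : ℕ → Exp f n
  numeral zero    = nil
  numeral (suc m) = nil ∙ numeral m

  tagged : ℕ → Exp f n → Exp f n
  tagged m e = numeral m ∙ e

  plus2 : Exp f n → Exp f n
  plus2 e = nil ∙ (nil ∙ e)

  markExp : Exp f n → Exp f n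
  markExp e = tagged 0 (tagged 1 e)

  enterExp leaveExp alwaysExp : Exp f n
  enterExp  = tagged 0 (tagged 1 nil)
  leaveExp  = tagged 1 (tagged 1 nil)
  alwaysExp = tagged 0 (nil ∙ nil)

  lastMarkExp : Exp f n → Exp f n
  lastMarkExp e = tagged 3 (markExp e ∙ nil) ∙ nil

module _ {f n : ℕ} where

  termExp : Fin n → Exp f n
  termExp v = case (var v) nil (lastMarkExp (var (# 1)))

  -- The sign stays outermost; the tag 0 of `inj₁` is inserted beneath it.
  letterExp : Fin n → Exp f n
  letterExp v = case (var v) nil (var (# 0) ∙ tagged 0 (var (# 1)))

pattern conF     = zero
pattern storingF = suc zero
pattern remF     = suc (suc zero)
pattern storedF  = suc (suc (suc zero))
pattern countF   = suc (suc (suc (suc zero)))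
pattern closeF   = suc (suc (suc (suc (suc zero))))
pattern liftF    = suc (suc (suc (suc (suc (suc zero)))))
pattern loopsF   = suc (suc (suc (suc (suc (suc (suc zero))))))
pattern loopF    = suc (suc (suc (suc (suc (suc (suc (suc zero)))))))
pattern valuesF  = suc (suc (suc (suc (suc (suc (suc (suc (suc zero))))))))

conBody storingBody remBody storedBody countBody closeBody liftBody loopsBody loopBody valuesBody
  mainBody : Exp 10 1

-- The unary tag is peeled off unit by unit. Each distinction binds two variables, so the payload is
-- `# 1`, `# 3`, `# 5` in turn; the `nil` results answer trees that encode nothing. Tags 2 and 3
-- mean the same in both encodings, so the original tag is copied as `# 6`.
conBody =
  case (var (# 0)) nil
  (case (var (# 0))
    (case (var (# 1)) nil (tagged 0 (termExp (# 0) ∙ termExp (# 1))))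
  (case (var (# 1))
    (case (var (# 3)) nil (tagged 1 (termExp (# 0) ∙ termExp (# 1))))
    (case (var (# 5)) nil (var (# 6) ∙ (call conF (var (# 0)) ∙ call conF (var (# 1)))))))

storingBody =
  case (var (# 0)) (tagged 0 nil)
  (tagged 4 (tagged 4 (tagged 1 (markExp (var (# 0))) ∙ tagged 1 leaveExp) ∙
             call storingF (var (# 1))))

-- Here the tags cannot be copied: concatenation and union, 3 and 4 in the input, are 4 and 3 in the
-- output.
remBody =
  case (var (# 0)) nil
  (case (var (# 0))
    (tagged 0 nil)
  (case (var (# 1))
    (tagged 2 (tagged 1 (nil ∙ nil)))
  (case (var (# 1))
    (tagged 1 (letterExp (# 5)))
  (case (var (# 1))
    (case (var (# 7)) nil (tagged 4 (call remF (var (# 0)) ∙ call remF (var (# 1)))))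
  (case (var (# 1))
    (case (var (# 9)) nil (tagged 3 (call remF (var (# 0)) ∙ call remF (var (# 1)))))
  (case (var (# 1))
    (tagged 5 (call remF (var (# 11))))
  (case (var (# 1))
    (case (var (# 13)) nil (tagged 4 (call storingF (var (# 0)) ∙ call remF (var (# 1)))))
    (case (var (# 15)) nil
      (tagged 4 (call remF (var (# 0)) ∙ tagged 2 (call conF (var (# 1)))))))))))))

storedBody =
  case (var (# 0)) alwaysExp
  (tagged 3 (tagged 0 (lastMarkExp (var (# 0)) ∙ nil) ∙ call storedF (var (# 1))))

-- The empty list contributes the two states of the closing detour, each transition two more.
countBody =
  case (var (# 0)) nil
  (case (var (# 0)) (plus2 (var (# 1)))
    (plus2 (call countF (var (# 1) ∙ var (# 3)))))

-- The argument is (F , nw , nd , δw , δd); the result consists of the rules for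
-- the closing detour followed by those of liftBody.
closeBody =
  case (var (# 0)) nil
  (case (var (# 1)) nil
  (case (var (# 1)) nil
  (case (var (# 4))
    (case (var (# 1)) nil
      ((var (# 4) ∙ (leaveExp ∙ (nil ∙ var (# 2)))) ∙
       call liftF (var (# 0) ∙ (var (# 1) ∙ (plus2 (var (# 4)) ∙ plus2 (var (# 2)))))))
    ((var (# 0) ∙ (enterExp ∙ var (# 2))) ∙ call closeF (var (# 1) ∙ var (# 7))))))

-- The argument is (δw , δd , w , d), where w and d number the next new states.
liftBody =
  case (var (# 0)) nil
  (case (var (# 0)) (call loopsF (var (# 1)))
  (case (var (# 0)) nil
  (case (var (# 1)) nil
    ((var (# 2) ∙ (letterExp (# 0) ∙ var (# 1))) ∙ call liftF (var (# 5) ∙ var (# 7))))))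

-- The argument is (δd , w , d).
loopsBody =
  case (var (# 0)) nil
  (case (var (# 0)) nil
  (case (var (# 0)) nil
  (case (var (# 1)) nil
  (case (var (# 1)) nil
    (call loopF (var (# 1) ∙ (var (# 9) ∙ var (# 7))))))))

-- The argument is (X , (w , d) , δd), with X what is left of the current
-- transition and δd the transitions after it.
loopBody =
  case (var (# 0)) nil
  (case (var (# 1)) nil
  (case (var (# 0)) nil
  (case (var (# 4))
    (((nil ∙ var (# 0)) ∙ (leaveExp ∙ var (# 1))) ∙
     call loopsF (var (# 3) ∙ (plus2 (var (# 0)) ∙ plus2 (var (# 1)))))
    ((var (# 2) ∙ (markExp (var (# 0)) ∙ var (# 3))) ∙ call loopF (var (# 1) ∙ var (# 7))))))

-- The argument is (δd , w , d).
valuesBody =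
  case (var (# 0)) nil
  (case (var (# 0)) nil
  (case (var (# 0)) nil
  (case (var (# 1)) nil
  (case (var (# 1)) nil
  (case (var (# 9)) nil
    ((var (# 6) ∙ (tagged 3 (call conF (var (# 4)) ∙ call storedF (var (# 3))) ∙ var (# 2))) ∙
    ((var (# 6) ∙ (call conF (var (# 4)) ∙ var (# 0))) ∙
    ((var (# 1) ∙ (alwaysExp ∙ var (# 0))) ∙
    ((var (# 1) ∙ (alwaysExp ∙ (nil ∙ var (# 0)))) ∙
    ((var (# 1) ∙ (call storedF (var (# 3)) ∙ var (# 2))) ∙
     call valuesF (var (# 9) ∙ (plus2 (var (# 0)) ∙ plus2 (var (# 1))))))))))))))

-- After the five distinctions `nw`, `nd`, `δw`, `δd`, `I`, `F` are `# 8`, `# 6`, `# 4`, `# 2`,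
-- `# 0`, `# 1`. The list `I` is copied, since old states keep their numbers.
nraExp : Exp 10 7
nraExp =
  case (var (# 1)) nil
  (case (var (# 1)) nil
  (case (var (# 1)) nil
  (case (var (# 1)) nil
  (case (var (# 1)) nil
    (tagged 0
      (call countF (var (# 2) ∙ var (# 8)) ∙
      (call countF (var (# 2) ∙ var (# 6)) ∙
      (call closeF (var (# 1) ∙ (var (# 8) ∙ (var (# 6) ∙ (var (# 4) ∙ var (# 2))))) ∙
      (((var (# 6) ∙ (alwaysExp ∙ var (# 8))) ∙
        (((nil ∙ var (# 6)) ∙ (alwaysExp ∙ (nil ∙ var (# 8)))) ∙
         call valuesF (var (# 2) ∙ (plus2 (var (# 8)) ∙ plus2 (var (# 6)))))) ∙
      (var (# 0) ∙ ((nil ∙ var (# 8)) ∙ nil)))))))))))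

remExp : Exp 10 9
remExp =
  tagged 1 (tagged 4 (call remF (var (# 3)) ∙
                      tagged 4 (tagged 1 enterExp ∙ tagged 1 leaveExp)))

mainBody =
  case (var (# 0)) nil
  (case (var (# 1)) nil
  (case (var (# 0)) nil
    (var (# 4) ∙ (case (var (# 0)) nraExp remExp ∙ var (# 3)))))

program : Program
program = record
  { funs = 10
  ; body = conBody ∷ storingBody ∷ remBody ∷ storedBody ∷ countBody ∷ closeBody ∷
           liftBody ∷ loopsBody ∷ loopBody ∷ valuesBody ∷ []
  ; main = mainBody
  }

-- Execution of the program on encoded queries.

module Execution {s r k′ : ℕ} (r≤k : r ≤ suc k′) (M : ℕ) where
  open Translation {Fin s} r≤k

  _⊢_⟶_[_↝_] : ∀ {n} → Vec Tree n → Exp 10 n → Tree → ℕ → ℕ → Set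
  ρ ⊢ e ⟶ t [ a ↝ b ] = Runs program M ρ e t a b

  module _ {n} {ρ : Vec Tree n} {a : ℕ} where

    numeral-runs : ∀ m → ρ ⊢ numeral m ⟶ encodeℕ m [ a ↝ a ]
    numeral-runs zero    = nil
    numeral-runs (suc m) = nil ∙ numeral-runs m

    enter-runs : ρ ⊢ enterExp ⟶ encode enter [ a ↝ a ]
    enter-runs = nil ∙ ((nil ∙ nil) ∙ nil)

    leave-runs : ρ ⊢ leaveExp ⟶ encode leave [ a ↝ a ]
    leave-runs = (nil ∙ nil) ∙ ((nil ∙ nil) ∙ nil)

    always-runs : ρ ⊢ alwaysExp ⟶ encode always [ a ↝ a ]
    always-runs = nil ∙ (nil ∙ nil)

    as : ∀ {e t t′ b} → t ≡ t′ → ρ ⊢ e ⟶ t [ a ↝ b ] → ρ ⊢ e ⟶ t′ [ a ↝ b ]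
    as refl run = run

    mark-runs : ∀ x {e} → ρ ⊢ e ⟶ encode x [ a ↝ a ] → ρ ⊢ markExp e ⟶ encode (mark x) [ a ↝ a ]
    mark-runs x run =
      nil ∙ ((nil ∙ nil) ∙ as (cong encodeℕ (≡-sym (Fin.toℕ-inject≤ x r≤k))) run)

    lastMark-runs : ∀ x {e} → ρ ⊢ e ⟶ encode x [ a ↝ a ] →
                    ρ ⊢ lastMarkExp e ⟶ encodeTerm (term (suc x)) [ a ↝ a ]
    lastMark-runs x run = (numeral-runs 3 ∙ (mark-runs x run ∙ nil)) ∙ nil

  module _ {n} {ρ : Vec Tree n} {a : ℕ} where

    term-runs : ∀ i {v} → Vec.lookup ρ v ≡ encode i →
                ρ ⊢ termExp v ⟶ encodeTerm (term i) [ a ↝ a ]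
    term-runs zero    eq = case₁ eq nil
    term-runs (suc x) eq = case₂ eq (lastMark-runs x (var _))

    letter-runs : ∀ (l : Fin s ±) {v} → Vec.lookup ρ v ≡ encode l →
                  ρ ⊢ letterExp v ⟶ encode (liftLetter l) [ a ↝ a ]
    letter-runs (pos _) eq = case₂ eq (var _ ∙ (nil ∙ var _))
    letter-runs (neg _) eq = case₂ eq (var _ ∙ (nil ∙ var _))

  -- The credit needed so that `a` remains. Threading it in evaluation order makes the indices of
  -- `Runs` match definitionally.
  conCalls : Constraint r → ℕ → ℕ
  conCalls (_ ∼ _)  a = a
  conCalls (_ ≁ _)  a = a
  conCalls (c ∨ c′) a = suc (conCalls c (suc (conCalls c′ a)))
  conCalls (c ∧ c′) a = suc (conCalls c (suc (conCalls c′ a)))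

  con-runs : ∀ c {a} → (encode c ∷ []) ⊢ conBody ⟶ encode (rigid c) [ conCalls c a ↝ a ]
  con-runs (i ∼ j)  =
    case₂ refl (case₁ refl (case₂ refl (numeral-runs 0 ∙ (term-runs i refl ∙ term-runs j refl))))
  con-runs (i ≁ j)  =
    case₂ refl (case₂ refl (case₁ refl (case₂ refl
      (numeral-runs 1 ∙ (term-runs i refl ∙ term-runs j refl)))))
  con-runs (c ∨ c′) =
    case₂ refl (case₂ refl (case₂ refl (case₂ refl
      (var _ ∙ (callVar (con-runs c) ∙ callVar (con-runs c′))))))
  con-runs (c ∧ c′) =
    case₂ refl (case₂ refl (case₂ refl (case₂ refl
      (var _ ∙ (callVar (con-runs c) ∙ callVar (con-runs c′))))))

  storing-runs : ∀ X {a} → (encode X ∷ []) ⊢ storingBody ⟶ encode (storing X) [ length X + a ↝ a ]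
  storing-runs []      = case₁ refl (nil ∙ nil)
  storing-runs (x ∷ X) = case₂ refl
    (numeral-runs 4 ∙
     ((numeral-runs 4 ∙ ((numeral-runs 1 ∙ mark-runs x (var _)) ∙ (numeral-runs 1 ∙ leave-runs))) ∙
      callVar (storing-runs X)))

  stored-runs : ∀ X {a} → (encode X ∷ []) ⊢ storedBody ⟶ encode (stored X) [ length X + a ↝ a ]
  stored-runs []      = case₁ refl always-runs
  stored-runs (x ∷ X) = case₂ refl
    (numeral-runs 3 ∙ ((nil ∙ (lastMark-runs x (var _) ∙ nil)) ∙ callVar (stored-runs X)))

  remCalls : REM (Fin s ±) r → ℕ → ℕ
  remCalls ε         a = a
  remCalls ∅         a = a
  remCalls (sym _)   a = a
  remCalls (e₁ · e₂) a = suc (remCalls e₁ (suc (remCalls e₂ a)))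
  remCalls (e₁ ∪ e₂) a = suc (remCalls e₁ (suc (remCalls e₂ a)))
  remCalls (e ⁺)     a = suc (remCalls e a)
  remCalls (↓ X e)   a = suc (length X + suc (remCalls e a))
  remCalls (e ⟦ c ⟧) a = suc (remCalls e (suc (conCalls c a)))

  rem-runs : ∀ e {a} → (encode e ∷ []) ⊢ remBody ⟶ encode (rrem e) [ remCalls e a ↝ a ]
  rem-runs ε = case₂ refl (case₁ refl (nil ∙ nil))
  rem-runs ∅ = case₂ refl (case₂ refl (case₁ refl (numeral-runs 2 ∙ (numeral-runs 1 ∙ (nil ∙ nil)))))
  rem-runs (sym l) =
    case₂ refl (case₂ refl (case₂ refl (case₁ refl (numeral-runs 1 ∙ letter-runs l refl))))
  rem-runs (e₁ · e₂) =
    case₂ refl (case₂ refl (case₂ refl (case₂ refl (case₁ refl (case₂ refl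
      (numeral-runs 4 ∙ (callVar (rem-runs e₁) ∙ callVar (rem-runs e₂))))))))
  rem-runs (e₁ ∪ e₂) =
    case₂ refl (case₂ refl (case₂ refl (case₂ refl (case₂ refl (case₁ refl (case₂ refl
      (numeral-runs 3 ∙ (callVar (rem-runs e₁) ∙ callVar (rem-runs e₂)))))))))
  rem-runs (e ⁺) =
    case₂ refl (case₂ refl (case₂ refl (case₂ refl (case₂ refl (case₂ refl (case₁ refl
      (numeral-runs 5 ∙ callVar (rem-runs e))))))))
  rem-runs (↓ X e) =
    case₂ refl (case₂ refl (case₂ refl (case₂ refl (case₂ refl (case₂ refl (case₂ refl (case₁ refl
      (case₂ refl (numeral-runs 4 ∙ (callVar (storing-runs X) ∙ callVar (rem-runs e)))))))))))
  rem-runs (e ⟦ c ⟧) =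
    case₂ refl (case₂ refl (case₂ refl (case₂ refl (case₂ refl (case₂ refl (case₂ refl (case₂ refl
      (case₂ refl (numeral-runs 4 ∙
        (callVar (rem-runs e) ∙ (numeral-runs 2 ∙ callVar (con-runs c))))))))))))

  count-runs : ∀ {A : Set} ⦃ _ : Encodable A ⦄ (ts : List A) n {a} →
    size (encode ts ∙ encode n) ≤ M →
    ((encode ts ∙ encode n) ∷ []) ⊢ countBody
      ⟶ encodeℕ (length ts * 2 + suc (suc n)) [ length ts + a ↝ a ]
  count-runs []       n h = case₂ refl (case₁ refl (nil ∙ (nil ∙ var _)))
  count-runs (t ∷ ts) n h = case₂ refl (case₂ refl
    (nil ∙ (nil ∙ call (var _ ∙ var _) h′ (count-runs ts n h′))))
    where
    h′ : size (encode ts ∙ encode n) ≤ M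
    h′ = ≤-trans (size-tail (encode t) (encode ts) (encode n)) h

  module _ (𝓐 : NRA (Fin s ±) r) where
    open NRA 𝓐
    open Automaton r≤k 𝓐

    Transition : Set
    Transition = Qd × Constraint r × Qw × List (Fin r)

    oldW : ∀ (q : Qw) → encode q ≡ encode (codeW (old q))
    oldW q = cong encodeℕ (≡-sym (Fin.toℕ-↑ˡ q (suc T * 2)))

    oldD : ∀ (q : Qd) → encode q ≡ encode (codeD (old q))
    oldD q = cong encodeℕ (≡-sym (Fin.toℕ-↑ˡ q (suc T * 2)))

    toℕ-new : ∀ n j b → toℕ (code {n} {T} (new j b)) ≡ toℕ j * 2 + (toℕ b + n)
    toℕ-new n j b =
      trans (Fin.toℕ-↑ʳ n (combine j b))
        (trans (cong (n +_) (Fin.toℕ-combine j b)) (rearrange n (toℕ j) (toℕ b)))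
      where
      rearrange : ∀ n j b → n + (2 * j + b) ≡ j * 2 + (b + n)
      rearrange = solve-∀

    -- The transitions ts, reached through κ, use the new states numbered from n.
    Numbered : ∀ {m} → (Fin m → Fin T) → ℕ → ℕ → Set
    Numbered κ n₀ n = ∀ i b → toℕ (code {n₀} {T} (new (suc (κ i)) b)) ≡ toℕ i * 2 + (toℕ b + n)

    shift : ∀ i b n → suc (suc i) + (b + n) ≡ i + (b + suc (suc n))
    shift = solve-∀

    numbered-suc : ∀ {m} {κ : Fin (suc m) → Fin T} {n₀ n} →
                   Numbered κ n₀ n → Numbered (κ ∘ suc) n₀ (suc (suc n))
    numbered-suc {n = n} num i b = trans (num (suc i) b) (shift (toℕ i * 2) (toℕ b) n)

    numbered : ∀ n → Numbered (λ i → i) n (suc (suc n))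
    numbered n i b = trans (toℕ-new n (suc i) b) (shift (toℕ i * 2) (toℕ b) n)

    size-rules : ∀ t ts w d → t + (3 + (ts + (w + d))) ≡ suc (suc (t + ts) + suc (w + d))
    size-rules = solve-∀

    -- Dropping a transition pays for increasing both counters by two.
    room : ∀ (t : Transition) (ts : List Transition) w d →
           size (encode ts ∙ ((nil ∙ (nil ∙ w)) ∙ (nil ∙ (nil ∙ d)))) ≤
           size (encodeList (t ∷ ts) ∙ (w ∙ d))
    room t@(q , c , q′ , X) ts w d = begin
      suc (size (encode ts) + suc ((4 + size w) + (4 + size d)))
        ≡⟨ rearrange (size (encode ts)) (size w) (size d) ⟩
      7 + (3 + (size (encode ts) + (size w + size d)))
        ≤⟨ +-monoˡ-≤ _ (s≤s (+-mono-≤ (size-positive (encode q)) (s≤s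
             (+-mono-≤ (size-positive (encode c)) (s≤s
             (+-mono-≤ (size-positive (encode q′)) (size-positive (encode X)))))))) ⟩
      size (encode t) + (3 + (size (encode ts) + (size w + size d)))
        ≡⟨ size-rules (size (encode t)) (size (encode ts)) (size w) (size d) ⟩
      size (encodeList (t ∷ ts) ∙ (w ∙ d)) ∎
      where
      open ≤-Reasoning
      rearrange : ∀ ts w d → suc (ts + suc ((4 + w) + (4 + d))) ≡ 7 + (3 + (ts + (w + d)))
      rearrange = solve-∀

    -- Once `X` is exhausted, both counters grow by two, that is by eight in size, while the
    -- argument loses two: hence the reserve 6. It is paid for by dropping `q`, `c` and `q′` with
    -- the three pairs that hold them.
    room-loop : ∀ q c q′ X (ts : List Transition) w d →
                6 + size (encode X ∙ ((w ∙ d) ∙ encode ts)) ≤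
                size (encodeList ((Transition ∋ (q , c , q′ , X)) ∷ ts) ∙ (w ∙ d))
    room-loop q c q′ X ts w d = begin
      6 + suc (size (encode X) + suc (suc (size w + size d) + size (encode ts)))
        ≡⟨ rearrange (size (encode X)) (size (encode ts)) (size w) (size d) ⟩
      (6 + size (encode X)) + (3 + (size (encode ts) + (size w + size d)))
        ≤⟨ +-monoˡ-≤ _ (s≤s (+-mono-≤ (size-positive (encode q)) (s≤s
             (+-mono-≤ (size-positive (encode c)) (s≤s
             (+-monoˡ-≤ (size (encode X)) (size-positive (encode q′)))))))) ⟩
      size (encode (Transition ∋ (q , c , q′ , X))) + (3 + (size (encode ts) + (size w + size d)))
        ≡⟨ size-rules (size (encode (Transition ∋ (q , c , q′ , X)))) (size (encode ts)) (size w) (size d) ⟩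
      size (encodeList ((Transition ∋ (q , c , q′ , X)) ∷ ts) ∙ (w ∙ d)) ∎
      where
      open ≤-Reasoning
      rearrange : ∀ X ts w d →
                  6 + suc (X + suc (suc (w + d) + ts)) ≡ (6 + X) + (3 + (ts + (w + d)))
      rearrange = solve-∀

    valueCalls : List Transition → ℕ → ℕ
    valueCalls []                      a = a
    valueCalls ((q , c , q′ , X) ∷ ts) a =
      suc (conCalls c (suc (length X + suc (conCalls c (suc (length X + suc (valueCalls ts a)))))))

    values-runs : ∀ (ts : List Transition) (κ : Fin (length ts) → Fin T) w d {a} →
      Numbered κ nw w → Numbered κ nd d →
      size (encode ts ∙ (encode w ∙ encode d)) ≤ M →
      ((encode ts ∙ (encode w ∙ encode d)) ∷ []) ⊢ valuesBody
        ⟶ encode (blocks ts (valueBlock ∘ κ)) [ valueCalls ts a ↝ a ]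
    values-runs [] κ w d numw numd h = case₂ refl (case₁ refl nil)
    values-runs (t@(q , c , q′ , X) ∷ ts) κ w d numw numd h =
      case₂ refl (case₂ refl (case₂ refl (case₂ refl (case₂ refl (case₂ refl
        ((as (oldD q) (var _) ∙
          ((numeral-runs 3 ∙ (callVar (con-runs c) ∙ callVar (stored-runs X))) ∙ as (oldW q′) (var _))) ∙
        ((as (oldD q) (var _) ∙ (callVar (con-runs c) ∙ as (new≡ numw at₀) (var _))) ∙
        ((as (new≡ numd at₀) (var _) ∙ (always-runs ∙ as (new≡ numw at₀) (var _))) ∙
        ((as (new≡ numd at₀) (var _) ∙ (always-runs ∙ as (new≡ numw at₁) (nil ∙ var _))) ∙
        ((as (new≡ numd at₀) (var _) ∙ (callVar (stored-runs X) ∙ as (oldW q′) (var _))) ∙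
        call (var _ ∙ ((nil ∙ (nil ∙ var _)) ∙ (nil ∙ (nil ∙ var _)))) h′
          (values-runs ts (κ ∘ suc) (2 + w) (2 + d)
             (numbered-suc {κ = κ} numw) (numbered-suc {κ = κ} numd) h′)))))))))))
      where
      h′ : size (encode ts ∙ (encode (2 + w) ∙ encode (2 + d))) ≤ M
      h′ = ≤-trans (room t ts (encode w) (encode d)) h

      new≡ : ∀ {n₀ n} → Numbered κ n₀ n → ∀ b →
             encode (toℕ b + n) ≡ encode (code {n₀} {T} (new (suc (κ zero)) b))
      new≡ num b = cong encodeℕ (≡-sym (num zero b))

    loopCalls : List Transition → ℕ → ℕ
    loopCalls []                      a = a
    loopCalls ((q , c , q′ , X) ∷ ts) a = suc (length X + suc (loopCalls ts a))

    loops-runs : ∀ (ts : List Transition) (κ : Fin (length ts) → Fin T) w d {a} →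
      Numbered κ nw w → Numbered κ nd d →
      size (encode ts ∙ (encode w ∙ encode d)) ≤ M →
      ((encode ts ∙ (encode w ∙ encode d)) ∷ []) ⊢ loopsBody
        ⟶ encode (blocks ts (letterBlock ∘ κ)) [ loopCalls ts a ↝ a ]
    loop-runs : ∀ X (t : Transition) ts (κ : Fin (length (t ∷ ts)) → Fin T) w d {a} →
      Numbered κ nw w → Numbered κ nd d →
      6 + size (encode X ∙ ((encode w ∙ encode d) ∙ encode ts)) ≤ M →
      ((encode X ∙ ((encode w ∙ encode d) ∙ encode ts)) ∷ []) ⊢ loopBody
        ⟶ encode ((map (λ x → codeW (new (suc (κ zero)) at₀) , mark x , codeD (new (suc (κ zero)) at₀)) X ++
                   (codeW (new (suc (κ zero)) at₁) , leave , codeD (new (suc (κ zero)) at₀)) ∷ []) ++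
                  blocks ts (letterBlock ∘ κ ∘ suc))
        [ length X + suc (loopCalls ts a) ↝ a ]
    loops-runs [] κ w d numw numd h = case₂ refl (case₁ refl nil)
    loops-runs (t@(q , c , q′ , X) ∷ ts) κ w d numw numd h =
      case₂ refl (case₂ refl (case₂ refl (case₂ refl (case₂ refl
        (call (var _ ∙ (var _ ∙ var _)) (≤-trans (m≤n+m _ 6) h′)
          (loop-runs X t ts κ w d numw numd h′))))))
      where
      h′ : 6 + size (encode X ∙ ((encode w ∙ encode d) ∙ encode ts)) ≤ M
      h′ = ≤-trans (room-loop q c q′ X ts (encode w) (encode d)) h
    loop-runs [] t ts κ w d numw numd h =
      case₂ refl (case₂ refl (case₂ refl (case₁ refl
        ((as (cong encodeℕ (≡-sym (numw zero at₁))) (nil ∙ var _) ∙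
          (leave-runs ∙ as (cong encodeℕ (≡-sym (numd zero at₀))) (var _))) ∙
         call (var _ ∙ ((nil ∙ (nil ∙ var _)) ∙ (nil ∙ (nil ∙ var _)))) h′
           (loops-runs ts (κ ∘ suc) (2 + w) (2 + d)
              (numbered-suc {κ = κ} numw) (numbered-suc {κ = κ} numd) h′)))))
      where
      arith : ∀ ts w d → suc (ts + suc ((4 + w) + (4 + d))) ≡ 6 + suc (1 + suc (suc (w + d) + ts))
      arith = solve-∀
      h′ : size (encode ts ∙ (encode (2 + w) ∙ encode (2 + d))) ≤ M
      h′ = ≤-trans (≤-reflexive (arith (size (encode ts)) (size (encode w)) (size (encode d)))) h
    loop-runs (x ∷ X) t ts κ w d numw numd h =
      case₂ refl (case₂ refl (case₂ refl (case₂ refl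
        ((as (cong encodeℕ (≡-sym (numw zero at₀))) (var _) ∙
          (mark-runs x (var _) ∙ as (cong encodeℕ (≡-sym (numd zero at₀))) (var _))) ∙
         call (var _ ∙ var _) (≤-trans (m≤n+m _ 6) h′) (loop-runs X t ts κ w d numw numd h′)))))
      where
      h′ : 6 + size (encode X ∙ ((encode w ∙ encode d) ∙ encode ts)) ≤ M
      h′ = ≤-trans (+-monoʳ-≤ 6 (size-tail (encode x) (encode X)
                                           ((encode w ∙ encode d) ∙ encode ts))) h

    lift-runs : ∀ (ls : List (Qw × Fin s ± × Qd)) {a} →
      size (encode ls ∙ (encode δd ∙ (encode (2 + nw) ∙ encode (2 + nd)))) ≤ M →
      ((encode ls ∙ (encode δd ∙ (encode (2 + nw) ∙ encode (2 + nd)))) ∷ []) ⊢ liftBody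
        ⟶ encode (map (λ (q , a , q′) → codeW (old q) , liftLetter a , codeD (old q′)) ls ++
                  blocks δd letterBlock)
        [ length ls + suc (loopCalls δd a) ↝ a ]
    lift-runs [] h =
      case₂ refl (case₁ refl (callVar (loops-runs δd (λ i → i) (2 + nw) (2 + nd)
        (numbered nw) (numbered nd) (size-right nil (encode δd ∙ (encode (2 + nw) ∙ encode (2 + nd))) h))))
    lift-runs ((q , l , q′) ∷ ls) h =
      case₂ refl (case₂ refl (case₂ refl (case₂ refl
        ((as (oldW q) (var _) ∙ (letter-runs l refl ∙ as (oldD q′) (var _))) ∙
         call (var _ ∙ var _) h′ (lift-runs ls h′)))))
      where
      h′ = ≤-trans (size-tail (encode (q , l , q′)) (encode ls)
                              (encode δd ∙ (encode (2 + nw) ∙ encode (2 + nd)))) h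

    newW : ∀ b → encode (toℕ b + nw) ≡ encode (codeW (new zero b))
    newW b = cong encodeℕ (≡-sym (toℕ-new nw zero b))

    newD : ∀ b → encode (toℕ b + nd) ≡ encode (codeD (new zero b))
    newD b = cong encodeℕ (≡-sym (toℕ-new nd zero b))

    -- The reserve 6 pays, when `fs` is used up, for passing both counters on increased by two.
    close-runs : ∀ (fs : List Qw) {a} →
      6 + size (encode fs ∙ (encode nw ∙ (encode nd ∙ (encode δw ∙ encode δd)))) ≤ M →
      ((encode fs ∙ (encode nw ∙ (encode nd ∙ (encode δw ∙ encode δd)))) ∷ []) ⊢ closeBody
        ⟶ encode (map (λ q → codeW (old q) , enter , codeD (new zero at₀)) fs ++
                  (codeW (new zero at₀) , leave , codeD (new zero at₁)) ∷
                  map (λ (q , a , q′) → codeW (old q) , liftLetter a , codeD (old q′)) δw ++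
                  blocks δd letterBlock)
        [ length fs + suc (length δw + suc (loopCalls δd a)) ↝ a ]
    close-runs [] h =
      case₂ refl (case₂ refl (case₂ refl (case₁ refl (case₂ refl
        ((as (newW at₀) (var _) ∙ (leave-runs ∙ as (newD at₁) (nil ∙ var _))) ∙
         call (var _ ∙ (var _ ∙ ((nil ∙ (nil ∙ var _)) ∙ (nil ∙ (nil ∙ var _))))) h′
           (lift-runs δw h′))))))
      where
      rearrange : ∀ w d l t → suc (l + suc (t + suc ((4 + w) + (4 + d)))) ≡
                              6 + suc (1 + suc (w + suc (d + suc (l + t))))
      rearrange = solve-∀
      h′ : size (encode δw ∙ (encode δd ∙ (encode (2 + nw) ∙ encode (2 + nd)))) ≤ M
      h′ = ≤-trans (≤-reflexive (rearrange (size (encode nw)) (size (encode nd))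
                                           (size (encode δw)) (size (encode δd)))) h
    close-runs (f ∷ fs) h =
      case₂ refl (case₂ refl (case₂ refl (case₂ refl
        ((as (oldW f) (var _) ∙ (enter-runs ∙ as (newD at₀) (var _))) ∙
         call (var _ ∙ var _) (≤-trans (m≤n+m _ 6) h′) (close-runs fs h′)))))
      where
      h′ : 6 + size (encode fs ∙ (encode nw ∙ (encode nd ∙ (encode δw ∙ encode δd)))) ≤ M
      h′ = ≤-trans (+-monoʳ-≤ 6 (size-tail (encode f) (encode fs)
             (encode nw ∙ (encode nd ∙ (encode δw ∙ encode δd))))) h

    nraCalls : ℕ → ℕ
    nraCalls a =
      suc (length δd + suc (length δd + suc (length F + suc (length δw + suc (loopCalls δd
        (suc (valueCalls δd a)))))))

    -- The 10 leaves room for arguments assembled from components of the automaton. The tightest are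
    -- the one of `closeF` with its reserve, in `e₄`, and the one of `valuesF` with raised counters,
    -- in `e₅`.
    nra-runs : ∀ (ρ : Vec Tree 5) {a} → 10 + size (encode 𝓐) ≤ M →
      (nil ∷ encode 𝓐 ∷ ρ) ⊢ nraExp ⟶ tag 0 (encode nrra) [ nraCalls a ↝ a ]
    nra-runs ρ h =
      case₂ refl (case₂ refl (case₂ refl (case₂ refl (case₂ refl
        (nil ∙
         (call (var _ ∙ var _) (≤-trans (≤-slack _ (e₁ w d l t i f)) h)
               (as (count≡ nw) (count-runs δd nw (≤-trans (≤-slack _ (e₁ w d l t i f)) h))) ∙
         (call (var _ ∙ var _) (≤-trans (≤-slack _ (e₂ w d l t i f)) h)
               (as (count≡ nd) (count-runs δd nd (≤-trans (≤-slack _ (e₂ w d l t i f)) h))) ∙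
         (call (var _ ∙ (var _ ∙ (var _ ∙ (var _ ∙ var _))))
               (≤-trans (≤-slack _ (e₃ w d l t i f)) h)
               (close-runs F (≤-trans (≤-slack _ (e₄ w d l t i f)) h)) ∙
         (((as (newD at₀) (var _) ∙ (always-runs ∙ as (newW at₀) (var _))) ∙
           ((as (newD at₁) (nil ∙ var _) ∙ (always-runs ∙ as (newW at₁) (nil ∙ var _))) ∙
            call (var _ ∙ ((nil ∙ (nil ∙ var _)) ∙ (nil ∙ (nil ∙ var _))))
                 (≤-trans (≤-slack _ (e₅ w d l t i f)) h)
                 (values-runs δd (λ i → i) (2 + nw) (2 + nd) (numbered nw) (numbered nd)
                    (≤-trans (≤-slack _ (e₅ w d l t i f)) h)))) ∙
         (as (initial I) (var _) ∙ (as (newW at₁) (nil ∙ var _) ∙ nil)))))))))))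
      where
      w = size (encode nw)
      d = size (encode nd)
      l = size (encode δw)
      t = size (encode δd)
      i = size (encode I)
      f = size (encode F)

      e₁ : ∀ w d l t i f → suc (t + w) + (14 + (d + l + i + f)) ≡
                           10 + suc (w + suc (d + suc (l + suc (t + suc (i + f)))))
      e₁ = solve-∀
      e₂ : ∀ w d l t i f → suc (t + d) + (14 + (w + l + i + f)) ≡
                           10 + suc (w + suc (d + suc (l + suc (t + suc (i + f)))))
      e₂ = solve-∀
      e₃ : ∀ w d l t i f → suc (f + suc (w + suc (d + suc (l + t)))) + (11 + i) ≡
                           10 + suc (w + suc (d + suc (l + suc (t + suc (i + f)))))
      e₃ = solve-∀
      e₄ : ∀ w d l t i f → 6 + suc (f + suc (w + suc (d + suc (l + t)))) + (5 + i) ≡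
                           10 + suc (w + suc (d + suc (l + suc (t + suc (i + f)))))
      e₄ = solve-∀
      e₅ : ∀ w d l t i f → suc (t + suc ((4 + w) + (4 + d))) + (5 + (l + i + f)) ≡
                           10 + suc (w + suc (d + suc (l + suc (t + suc (i + f)))))
      e₅ = solve-∀

      count≡ : ∀ n → encode (T * 2 + suc (suc n)) ≡ encode (n + suc T * 2)
      count≡ n = cong encodeℕ (rearrange n (T * 2))
        where
        rearrange : ∀ n m → m + suc (suc n) ≡ n + suc (suc m)
        rearrange = solve-∀

      initial : ∀ qs → encode qs ≡ encode (map (codeD ∘ old) qs)
      initial []       = refl
      initial (q ∷ qs) = cong₂ _∙_ (oldD q) (initial qs)

  calls : 2RDPQ (Fin s) r → ℕ
  calls record { L = inj₁ 𝓐 } = nraCalls 𝓐 0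
  calls record { L = inj₂ e } = suc (remCalls e 0)

  main-runs : ∀ ξ → 10 + size (encode ξ) ≤ M →
              (encode ξ ∷ []) ⊢ mainBody ⟶ encode (translate r≤k ξ) [ calls ξ ↝ 0 ]
  main-runs record { x = x ; L = inj₁ 𝓐 ; y = y } h =
    case₂ refl (case₂ refl (case₂ refl
      (var _ ∙ (case₁ refl (nra-runs 𝓐 _ (≤-trans (+-monoʳ-≤ 10 below) h)) ∙ var _))))
    where
    below : size (encode 𝓐) ≤ size (encode x ∙ (tag 0 (encode 𝓐) ∙ encode y))
    below = size-right nil (encode 𝓐) (size-left (tag 0 (encode 𝓐)) (encode y)
              (size-right (encode x) (tag 0 (encode 𝓐) ∙ encode y) ≤-refl))
  main-runs record { x = x ; L = inj₂ e ; y = y } h =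
    case₂ refl (case₂ refl (case₂ refl
      (var _ ∙ (case₂ refl (numeral-runs 1 ∙ (numeral-runs 4 ∙
         (callVar (rem-runs e) ∙
          (numeral-runs 4 ∙ ((numeral-runs 1 ∙ enter-runs) ∙ (numeral-runs 1 ∙ leave-runs)))))) ∙
       var _))))

  -- Linear bounds on the number of calls.

  length≤size : ∀ {A : Set} ⦃ _ : Encodable A ⦄ (ts : List A) → length ts ≤ size (encode ts)
  length≤size []       = z≤n
  length≤size (t ∷ ts) = s≤s (≤-trans (length≤size ts) (m≤n+m _ (size (encode t))))

  two-calls : ∀ m n a → suc (m + suc (n + a)) ≡ 2 + (m + n) + a
  two-calls = solve-∀

  -- Calls are charged to the encoding: a binary node makes two, and its own tag and pairs are
  -- larger than that.
  conCalls-bound : ∀ c a → conCalls c a ≤ size (encode c) + a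
  conCalls-bound-pair : ∀ c c′ a →
    suc (conCalls c (suc (conCalls c′ a))) ≤ 2 + (size (encode c) + size (encode c′)) + a
  conCalls-bound (_ ∼ _)  a = m≤n+m a _
  conCalls-bound (_ ≁ _)  a = m≤n+m a _
  conCalls-bound (c ∨ c′) a = ≤-trans (conCalls-bound-pair c c′ a) (+-monoˡ-≤ a (s≤s (m≤n+m _ 5)))
  conCalls-bound (c ∧ c′) a = ≤-trans (conCalls-bound-pair c c′ a) (+-monoˡ-≤ a (s≤s (m≤n+m _ 7)))
  conCalls-bound-pair c c′ a =
    ≤-trans (s≤s (≤-trans (conCalls-bound c _)
                          (+-monoʳ-≤ (size (encode c)) (s≤s (conCalls-bound c′ a)))))
            (≤-reflexive (two-calls (size (encode c)) (size (encode c′)) a))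

  remCalls-bound : ∀ e a → remCalls e a ≤ size (encode e) + a
  remCalls-bound-pair : ∀ e e′ a →
    suc (remCalls e (suc (remCalls e′ a))) ≤ 2 + (size (encode e) + size (encode e′)) + a
  remCalls-bound ε         a = m≤n+m a _
  remCalls-bound ∅         a = m≤n+m a _
  remCalls-bound (sym _)   a = m≤n+m a _
  remCalls-bound (e₁ · e₂) a = ≤-trans (remCalls-bound-pair e₁ e₂ a) (+-monoˡ-≤ a (s≤s (m≤n+m _ 7)))
  remCalls-bound (e₁ ∪ e₂) a = ≤-trans (remCalls-bound-pair e₁ e₂ a) (+-monoˡ-≤ a (s≤s (m≤n+m _ 9)))
  remCalls-bound (e ⁺)     a = s≤s (≤-trans (remCalls-bound e a) (m≤n+m _ 11))
  remCalls-bound (↓ X e)   a =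
    ≤-trans (s≤s (+-mono-≤ (length≤size X) (s≤s (remCalls-bound e a))))
      (≤-trans (≤-reflexive (two-calls (size (encode X)) (size (encode e)) a))
               (+-monoˡ-≤ a (s≤s (m≤n+m _ 13))))
  remCalls-bound (e ⟦ c ⟧) a =
    ≤-trans (s≤s (≤-trans (remCalls-bound e _)
                          (+-monoʳ-≤ (size (encode e)) (s≤s (conCalls-bound c a)))))
      (≤-trans (≤-reflexive (two-calls (size (encode e)) (size (encode c)) a))
               (+-monoˡ-≤ a (s≤s (m≤n+m _ 15))))
  remCalls-bound-pair e e′ a =
    ≤-trans (s≤s (≤-trans (remCalls-bound e _)
                          (+-monoʳ-≤ (size (encode e)) (s≤s (remCalls-bound e′ a)))))
            (≤-reflexive (two-calls (size (encode e)) (size (encode e′)) a))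

  module _ (𝓐 : NRA (Fin s ±) r) where
    open NRA 𝓐

    loopCalls-bound : ∀ ts a → loopCalls 𝓐 ts a ≤ size (encode ts) + a
    loopCalls-bound []                        a = n≤1+n a
    loopCalls-bound ((q , c , q′ , X) ∷ ts) a =
      ≤-trans (s≤s (+-mono-≤ (length≤size X) (s≤s (loopCalls-bound ts a))))
        (≤-slack _ (rearrange (size (encode q)) (size (encode c)) (size (encode q′))
                              (size (encode X)) (size (encode ts)) a))
      where
      rearrange : ∀ q c q′ X ts a → suc (X + suc (ts + a)) + (2 + (q + c + q′)) ≡
                                    suc (suc (q + suc (c + suc (q′ + X))) + ts) + a
      rearrange = solve-∀

    -- The factor 2 arises because the rules `direct` and `depart` both translate `c`, and `direct`
    -- and `finish` both translate `X`.
    valueCalls-bound : ∀ ts a → valueCalls 𝓐 ts a ≤ 2 * size (encode ts) + a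
    valueCalls-bound []                        a = m≤n+m a 2
    valueCalls-bound ((q , c , q′ , X) ∷ ts) a = begin
      suc (conCalls c (suc (x + suc (conCalls c (suc (x + suc (valueCalls 𝓐 ts a)))))))
        ≤⟨ s≤s (conCalls-bound c _) ⟩
      suc (C + suc (x + suc (conCalls c (suc (x + suc (valueCalls 𝓐 ts a))))))
        ≤⟨ s≤s (+-monoʳ-≤ C (s≤s (+-mono-≤ (length≤size X) (s≤s (conCalls-bound c _))))) ⟩
      suc (C + suc (Y + suc (C + suc (x + suc (valueCalls 𝓐 ts a)))))
        ≤⟨ s≤s (+-monoʳ-≤ C (s≤s (+-monoʳ-≤ Y (s≤s (+-monoʳ-≤ C (s≤s
             (+-mono-≤ (length≤size X) (s≤s (valueCalls-bound ts a))))))))) ⟩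
      suc (C + suc (Y + suc (C + suc (Y + suc (2 * size (encode ts) + a)))))
        ≤⟨ ≤-slack _ (rearrange (size (encode q)) C (size (encode q′)) Y (size (encode ts)) a) ⟩
      2 * size (encodeList ((Transition 𝓐 ∋ (q , c , q′ , X)) ∷ ts)) + a ∎
      where
      open ≤-Reasoning
      x = length X
      C = size (encode c)
      Y = size (encode X)
      rearrange : ∀ q c q′ X ts a →
        suc (c + suc (X + suc (c + suc (X + suc (2 * ts + a))))) + (3 + 2 * (q + q′)) ≡
        2 * suc (suc (q + suc (c + suc (q′ + X))) + ts) + a
      rearrange = solve-∀

    -- The 5 counts the charges to `δd`: two for counting states, one for the letter rules, two for
    -- the value rules.
    nraCalls-bound : nraCalls 𝓐 0 ≤ 5 * size (encode 𝓐)
    nraCalls-bound =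
      ≤-trans
        (s≤s (+-mono-≤ (length≤size δd) (s≤s (+-mono-≤ (length≤size δd) (s≤s
          (+-mono-≤ (length≤size F) (s≤s (+-mono-≤ (length≤size δw) (s≤s
            (≤-trans (loopCalls-bound δd _)
                     (+-monoʳ-≤ (size (encode δd)) (s≤s (valueCalls-bound δd 0)))))))))))))
        (≤-slack _ (rearrange (size (encode nw)) (size (encode nd)) (size (encode δw))
                              (size (encode δd)) (size (encode I)) (size (encode F))))
      where
      rearrange : ∀ w d l t i f →
        suc (t + suc (t + suc (f + suc (l + suc (t + suc (2 * t + 0)))))) +
          (19 + (5 * w + 5 * d + 4 * l + 5 * i + 4 * f)) ≡
        5 * suc (w + suc (d + suc (l + suc (t + suc (i + f)))))
      rearrange = solve-∀

  calls-bound : ∀ ξ → calls ξ ≤ 5 * size (encode ξ)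
  calls-bound record { x = x ; L = inj₁ 𝓐 ; y = y } =
    ≤-trans (nraCalls-bound 𝓐) (*-monoʳ-≤ 5 below)
    where
    below : size (encode 𝓐) ≤ size (encode x ∙ (tag 0 (encode 𝓐) ∙ encode y))
    below = size-right nil (encode 𝓐) (size-left (tag 0 (encode 𝓐)) (encode y)
              (size-right (encode x) (tag 0 (encode 𝓐) ∙ encode y) ≤-refl))
  calls-bound record { x = x ; L = inj₂ e ; y = y } =
    ≤-trans (≤-trans (s≤s (≤-trans (remCalls-bound e 0) (≤-reflexive (+-identityʳ _)))) below)
            (m≤n*m _ 5)
    where
    below : suc (size (encode e)) ≤ size (encode x ∙ (tag 1 (encode e) ∙ encode y))
    below = ≤-trans (s≤s (m≤n+m (size (encode e)) 3))
              (size-left (tag 1 (encode e)) (encode y)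
                (size-right (encode x) (tag 1 (encode e) ∙ encode y) ≤-refl))

-- The polynomial bound.

-- Opaque, because the actual exponent is large and must not be unfolded.
abstract
  degree : ℕ → ℕ → ℕ
  degree W B = 2 + 12 * (W + 5 * B)

  -- Here `11 + N` is `suc M` for `M = 10 + N`, and `11 + N ≤ 12 * N` turns the linear number of
  -- calls into a quadratic bound. One number has to serve as coefficient, exponent and addend, so
  -- `degree` adds 2 to the coefficient to be an admissible exponent.
  polynomial-bound : ∀ W B n N m → 1 ≤ N → n ≤ 5 * N →
    m ≤ W * (11 + N) + n * (B * (11 + N)) → m ≤ degree W B * N ^ degree W B + degree W B
  polynomial-bound W B n N@(suc N′) m _ n≤ m≤ = begin
    m
      ≤⟨ m≤ ⟩
    W * (11 + N) + n * (B * (11 + N))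
      ≤⟨ +-mono-≤ (m≤m*n (W * (11 + N)) N) (*-monoˡ-≤ (B * (11 + N)) n≤) ⟩
    W * (11 + N) * N + 5 * N * (B * (11 + N))
      ≡⟨ rearrange W B N (11 + N) ⟩
    (W + 5 * B) * N * (11 + N)
      ≤⟨ *-monoʳ-≤ ((W + 5 * B) * N) (+-monoˡ-≤ N (m≤m*n 11 N)) ⟩
    (W + 5 * B) * N * (11 * N + N)
      ≡⟨ rearrange′ (W + 5 * B) N ⟩
    12 * (W + 5 * B) * N ^ 2
      ≤⟨ *-mono-≤ {12 * (W + 5 * B)} {degree W B} (m≤n+m _ 2)
           (^-monoʳ-≤ N (m≤m+n 2 (12 * (W + 5 * B)))) ⟩
    degree W B * N ^ degree W B
      ≤⟨ m≤m+n _ _ ⟩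
    degree W B * N ^ degree W B + degree W B ∎
    where
    open ≤-Reasoning
    rearrange : ∀ W B N u → W * u * N + 5 * N * (B * u) ≡ (W + 5 * B) * N * u
    rearrange = solve-∀
    rearrange′ : ∀ W N → W * N * (11 * N + N) ≡ 12 * W * (N * (N * 1))
    rearrange′ = solve-∀

program-polynomial : ∀ {s r k′} (r≤k : r ≤ suc k′) (ξ : 2RDPQ (Fin s) r) →
  let c = degree (weight mainBody) (totalWeight (Program.body program)) in
  program computes encode ξ ↦ encode (translate r≤k ξ) within (c * size (encode ξ) ^ c + c)
program-polynomial r≤k ξ =
  let m , run , m≤ = cost program M (main-runs ξ ≤-refl) (λ { zero → m≤n+m _ 10 }) in
  m , polynomial-bound (weight mainBody) (totalWeight (Program.body program)) (calls ξ)
        (size (encode ξ)) m (size-positive (encode ξ)) (calls-bound ξ)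
        (≤-trans (m≤m+n m 0) m≤) , run
  where
  M = 10 + size (encode ξ)
  open Execution r≤k M

theorem4 : (D : Set) → Infinite D →
    ∃[ P ] ∃[ c ]
    ((s k r : ℕ) → 1 ≤ k → r ≤ k →
    (ξ : 2RDPQ (Fin s) r) →
    Σ[ ξ′ ∈ 2RRDPQ (Σ+A (Fin s) k) ]
    (2RRDPQ.x ξ′ ≡ 2RDPQ.x ξ
    × 2RRDPQ.y ξ′ ≡ 2RDPQ.y ξ
    × P computes encode ξ ↦ encode ξ′ within (c * size (encode ξ) ^ c + c)
    × ((𝓖 : DataGraph D (Fin s)) →
    embed 𝓖 k (2RDPQ.evaluate ξ 𝓖) ≐ 2RRDPQ.evaluate ξ′ (dataToNode 𝓖 k))))
theorem4 D _ = program , degree (weight mainBody) (totalWeight (Program.body program)) , λ where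
  s (suc k′) r _ r≤k ξ →
    translate r≤k ξ , refl , refl , program-polynomial r≤k ξ , translate-correct r≤k ξ
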